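{- For the crossed quadratic lattice, the entropy constant $\eta=\lim_{m,n\to\infty} f(m,n)^{1/((m+1)(n+1))}$ exists and satisfies $$1.342542258\le \eta\le 1.342652573 .$$
   Context: For positive integers $m,n$ the crossed quadratic lattice graph $\check G_{m,n}$ has vertices $(i,j)$ with $0\le i\le m$, $0\le j\le n$, two distinct vertices $(i,j),(i',j')$ being adjacent iff $|i-i'|\le 1$ and $|j-j'|\le 1$ (the grid graph with both diagonals added in each unit square). $f(m,n)$ is the number of independent sets (the empty set included) of $\check G_{m,n}$, and the limit is the double limit with $m,n\to\infty$ independently. -}

module Defs where

open import Data.Empty using (⊥)
open import Data.Fin.Base using (Fin; toℕ)
import Data.Fin.Properties as Fin
open import Data.Fin.Subset using (Subset; inside; outside)
import Data.Fin.Subset as Subset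
import Data.Fin.Subset.Properties as Subset
open import Data.Integer.Base using (+_)
open import Data.List.Base
  using (List; []; _∷_; [_]; cartesianProductWith; filter; length)
open import Data.Nat.Base as ℕ using (ℕ; zero; suc; NonZero)
import Data.Nat.Properties as ℕ
open import Data.Product.Base using (_×_; _,_; ∃; proj₁; proj₂)
open import Data.Product.Properties using (≡-dec)
open import Data.Rational.Base
  using (ℚ; 0ℚ; 1ℚ; _<_; _≤_; _+_; _*_; -_; _-_; 1/_; _/_; _⊓_; _⊔_;
         NonNegative; nonNegative; positive; +-*-rawSemiring)
open import Data.Rational.Properties
open import Data.Rational.Solver using (module +-*-Solver)
open import Data.Sum.Base using (_⊎_; inj₁; inj₂)
open import Data.Vec.Base using (Vec; []; _∷_; lookup)
open import Relation.Binary.PropositionalEquality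
  using (_≡_; _≢_; refl; sym; trans; cong; subst; subst₂)
open import Relation.Nullary.Decidable using (Dec; yes; no; ¬?; _×-dec_; _→-dec_)
open import Relation.Nullary.Negation using (¬_)

open import Algebra.Definitions.RawSemiring +-*-rawSemiring using (_^_) public

infix 4 _∈_ _∈?_ _<ʳ_ _≤ʳ_ ∣_-_∣<_
infixl 6 _+ℚ_

Vertex : ℕ → ℕ → Set
Vertex m n = Fin (suc m) × Fin (suc n)

Adjacent : ∀ {m n} → Vertex m n → Vertex m n → Set
Adjacent u@(i , j) v@(i′ , j′) =
  u ≢ v × ℕ.∣ toℕ i - toℕ i′ ∣ ℕ.≤ 1 × ℕ.∣ toℕ j - toℕ j′ ∣ ℕ.≤ 1

adjacent? : ∀ {m n} (u v : Vertex m n) → Dec (Adjacent u v)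
adjacent? u@(i , j) v@(i′ , j′) =
  ¬? (≡-dec Fin._≟_ Fin._≟_ u v)
    ×-dec (ℕ.∣ toℕ i - toℕ i′ ∣ ℕ.≤? 1)
    ×-dec (ℕ.∣ toℕ j - toℕ j′ ∣ ℕ.≤? 1)

-- A set of vertices is stored as the vector, indexed by i, of the sets
-- { j | (i , j) belongs to it }.  This representation is unique.
VertexSet : ℕ → ℕ → Set
VertexSet m n = Vec (Subset (suc n)) (suc m)

_∈_ : ∀ {m n} → Vertex m n → VertexSet m n → Set
(i , j) ∈ S = j Subset.∈ lookup S i

_∈?_ : ∀ {m n} (v : Vertex m n) (S : VertexSet m n) → Dec (v ∈ S)
(i , j) ∈? S = j Subset.∈? lookup S i

Independent : ∀ {m n} → VertexSet m n → Set
Independent {m} {n} S =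
  ∀ i j i′ j′ → (i , j) ∈ S → (i′ , j′) ∈ S → ¬ Adjacent {m} {n} (i , j) (i′ , j′)

independent? : ∀ {m n} (S : VertexSet m n) → Dec (Independent S)
independent? S =
  Fin.all? λ i → Fin.all? λ j → Fin.all? λ i′ → Fin.all? λ j′ →
    ((i , j) ∈? S) →-dec ((i′ , j′) ∈? S) →-dec ¬? (adjacent? (i , j) (i′ , j′))

-- All vectors of length n with entries from xs, without repetition if
-- xs has none.
vectors : ∀ {A : Set} → List A → ∀ n → List (Vec A n)
vectors xs zero    = [ [] ]
vectors xs (suc n) = cartesianProductWith _∷_ xs (vectors xs n)

vertexSets : ∀ m n → List (VertexSet m n)
vertexSets m n = vectors (vectors (outside ∷ inside ∷ []) (suc n)) (suc m)

-- The values for m = 0 or n = 0 do not affect the limit as m, n → ∞.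
f : ℕ → ℕ → ℕ
f m n = length (filter independent? (vertexSets m n))

-- Real numbers as located Dedekind cuts: L q means q < x and U q means
-- x < q.
record ℝ : Set₁ where
  field
    L U           : ℚ → Set
    L-inhabited   : ∃ λ q → L q
    U-inhabited   : ∃ λ q → U q
    L-downClosed  : ∀ {p q} → p < q → L q → L p
    L-open        : ∀ {p} → L p → ∃ λ q → p < q × L q
    U-upClosed    : ∀ {p q} → p < q → U p → U q
    U-open        : ∀ {q} → U q → ∃ λ p → p < q × U p
    disjoint      : ∀ {q} → L q → U q → ⊥
    located       : ∀ {p q} → p < q → L p ⊎ U q

open ℝ

_<ʳ_ : ℝ → ℝ → Set
x <ʳ y = ∃ λ q → U x q × L y q

_≤ʳ_ : ℝ → ℝ → Set
x ≤ʳ y = ∀ q → L x q → L y q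

fromℚ : ℚ → ℝ
fromℚ r = record
  { L            = _< r
  ; U            = r <_
  ; L-inhabited  = r - 1ℚ , r-1<r
  ; U-inhabited  = r + 1ℚ , r<r+1
  ; L-downClosed = <-trans
  ; L-open       = λ p<r → let (q , p<q , q<r) = <-dense p<r in q , p<q , q<r
  ; U-upClosed   = λ p<q r<p → <-trans r<p p<q
  ; U-open       = λ r<q → let (p , r<p , p<q) = <-dense r<q in p , p<q , r<p
  ; disjoint     = <-asym
  ; located      = loc
  }
  where
  r-1<r : r - 1ℚ < r
  r-1<r = subst (r - 1ℚ <_) (+-identityʳ r) (+-monoʳ-< r (negative⁻¹ (- 1ℚ)))

  r<r+1 : r < r + 1ℚ
  r<r+1 = subst (_< r + 1ℚ) (+-identityʳ r) (+-monoʳ-< r (positive⁻¹ 1ℚ))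

  loc : ∀ {p q} → p < q → p < r ⊎ r < q
  loc {p} p<q with p <? r
  ... | yes p<r = inj₁ p<r
  ... | no  p≮r = inj₂ (≤-<-trans (≮⇒≥ p≮r) p<q)

_+ℚ_ : ℝ → ℚ → ℝ
x +ℚ e = record
  { L            = λ q → L x (q - e)
  ; U            = λ q → U x (q - e)
  ; L-inhabited  = let (q , l) = L-inhabited x in q + e , subst (L x) (sym (cancel q)) l
  ; U-inhabited  = let (q , u) = U-inhabited x in q + e , subst (U x) (sym (cancel q)) u
  ; L-downClosed = λ p<q → L-downClosed x (+-monoˡ-< (- e) p<q)
  ; L-open       = λ l → let (q , lt , l′) = L-open x l in
                     q + e , subst (_< q + e) (cancel′ _) (+-monoˡ-< e lt)
                           , subst (L x) (sym (cancel q)) l′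
  ; U-upClosed   = λ p<q → U-upClosed x (+-monoˡ-< (- e) p<q)
  ; U-open       = λ u → let (p , lt , u′) = U-open x u in
                     p + e , subst (p + e <_) (cancel′ _) (+-monoˡ-< e lt)
                           , subst (U x) (sym (cancel p)) u′
  ; disjoint     = disjoint x
  ; located      = λ p<q → located x (+-monoˡ-< (- e) p<q)
  }
  where
  open +-*-Solver
  cancel : ∀ q → (q + e) - e ≡ q
  cancel q = solve 2 (λ q e → (q :+ e) :- e := q) refl q e
  cancel′ : ∀ q → (q - e) + e ≡ q
  cancel′ q = solve 2 (λ q e → (q :- e) :+ e := q) refl q e

∣_-_∣<_ : ℝ → ℝ → ℚ → Set
∣ x - y ∣< e = (x <ʳ (y +ℚ e)) × (y <ʳ (x +ℚ e))

IsDoubleLimit : (ℕ → ℕ → ℝ) → ℝ → Set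
IsDoubleLimit a l =
  ∀ e → 0ℚ < e → ∃ λ M → ∀ m n → M ℕ.≤ m → M ℕ.≤ n → ∣ a m n - l ∣< e

open ≤-Reasoning

*-monoʳ-≤′ : ∀ {r p q} → 0ℚ ≤ r → p ≤ q → r * p ≤ r * q
*-monoʳ-≤′ {r} 0≤r = *-monoˡ-≤-nonNeg r {{nonNegative 0≤r}}

*-monoˡ-≤′ : ∀ {r p q} → 0ℚ ≤ r → p ≤ q → p * r ≤ q * r
*-monoˡ-≤′ {r} 0≤r = *-monoʳ-≤-nonNeg r {{nonNegative 0≤r}}

*-monoʳ-<′ : ∀ {r p q} → 0ℚ < r → p < q → r * p < r * q
*-monoʳ-<′ {r} 0<r = *-monoʳ-<-pos r {{positive 0<r}}

*-monoˡ-<′ : ∀ {r p q} → 0ℚ < r → p < q → p * r < q * r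
*-monoˡ-<′ {r} 0<r = *-monoˡ-<-pos r {{positive 0<r}}

*-mono-≤′ : ∀ {a b c d} → 0ℚ ≤ b → 0ℚ ≤ c → a ≤ b → c ≤ d → a * c ≤ b * d
*-mono-≤′ 0≤b 0≤c a≤b c≤d = ≤-trans (*-monoˡ-≤′ 0≤c a≤b) (*-monoʳ-≤′ 0≤b c≤d)

^-nonNeg : ∀ {q} n → 0ℚ ≤ q → 0ℚ ≤ q ^ n
^-nonNeg     zero    0≤q = nonNegative⁻¹ 1ℚ
^-nonNeg {q} (suc n) 0≤q = begin
  0ℚ          ≡⟨ *-zeroʳ q ⟨
  q * 0ℚ      ≤⟨ *-monoʳ-≤′ 0≤q (^-nonNeg n 0≤q) ⟩
  q * q ^ n   ∎

^-pos : ∀ {q} n → 0ℚ < q → 0ℚ < q ^ n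
^-pos     zero    0<q = positive⁻¹ 1ℚ
^-pos {q} (suc n) 0<q = begin-strict
  0ℚ          ≡⟨ *-zeroʳ q ⟨
  q * 0ℚ      <⟨ *-monoʳ-<′ 0<q (^-pos n 0<q) ⟩
  q * q ^ n   ∎

^-mono-≤ : ∀ {p q} n → 0ℚ ≤ p → p ≤ q → p ^ n ≤ q ^ n
^-mono-≤ zero    0≤p p≤q = ≤-refl
^-mono-≤ (suc n) 0≤p p≤q =
  *-mono-≤′ (≤-trans 0≤p p≤q) (^-nonNeg n 0≤p) p≤q (^-mono-≤ n 0≤p p≤q)

^-mono-< : ∀ {p q} n .{{_ : NonZero n}} → 0ℚ ≤ p → p < q → p ^ n < q ^ n
^-mono-< {p} {q} (suc n) 0≤p p<q = begin-strict
  p * p ^ n   ≤⟨ *-monoʳ-≤′ 0≤p (^-mono-≤ n 0≤p (<⇒≤ p<q)) ⟩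
  p * q ^ n   <⟨ *-monoˡ-<′ (^-pos n (≤-<-trans 0≤p p<q)) p<q ⟩
  q * q ^ n   ∎

quotient : ∀ b {y} → 0ℚ < y → ∃ λ z → z * y ≡ b
quotient b {y} 0<y = b * 1/ y , trans (*-assoc b (1/ y) y)
  (trans (cong (b *_) (*-inverseˡ y)) (*-identityʳ b))
  where instance
    y≢0 = pos⇒nonZero y {{positive 0<y}}

p<p+q : ∀ p {q} → 0ℚ < q → p < p + q
p<p+q p {q} 0<q = subst (_< p + q) (+-identityʳ p) (+-monoʳ-< p 0<q)

<-⊓ : ∀ {a p q} → a < p → a < q → a < p ⊓ q
<-⊓ {a} {p} {q} a<p a<q with ⊓-sel p q
... | inj₁ eq = subst (a <_) (sym eq) a<p
... | inj₂ eq = subst (a <_) (sym eq) a<q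

⊔-< : ∀ {a p q} → p < a → q < a → p ⊔ q < a
⊔-< {a} {p} {q} p<a q<a with ⊔-sel p q
... | inj₁ eq = subst (_< a) (sym eq) p<a
... | inj₂ eq = subst (_< a) (sym eq) q<a

*-openˡ : ∀ {x y b} → 0ℚ ≤ x → 0ℚ ≤ y → x * y < b →
          ∃ λ d → 0ℚ < d × (x + d) * (y + d) < b
*-openˡ {x} {y} {b} 0≤x 0≤y xy<b = d , 0<d , bound
  where
  s = x + y + 1ℚ

  0<s : 0ℚ < s
  0<s = +-mono-≤-< (+-mono-≤ 0≤x 0≤y) (positive⁻¹ 1ℚ)

  z = proj₁ (quotient (b - x * y) 0<s)

  zs : z * s ≡ b - x * y
  zs = proj₂ (quotient (b - x * y) 0<s)

  0<z : 0ℚ < z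
  0<z = *-cancelʳ-<-nonNeg s {{nonNegative (<⇒≤ 0<s)}} (begin-strict
    0ℚ * s          ≡⟨ *-zeroˡ s ⟩
    0ℚ              ≡⟨ +-inverseʳ (x * y) ⟨
    x * y - x * y   <⟨ +-monoˡ-< (- (x * y)) xy<b ⟩
    b - x * y       ≡⟨ zs ⟨
    z * s           ∎)

  0<z⊓1 : 0ℚ < z ⊓ 1ℚ
  0<z⊓1 = <-⊓ 0<z (positive⁻¹ 1ℚ)

  d = proj₁ (<-dense 0<z⊓1)

  0<d : 0ℚ < d
  0<d = proj₁ (proj₂ (<-dense 0<z⊓1))

  d<z⊓1 : d < z ⊓ 1ℚ
  d<z⊓1 = proj₂ (proj₂ (<-dense 0<z⊓1))

  open +-*-Solver

  bound : (x + d) * (y + d) < b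
  bound = begin-strict
    (x + d) * (y + d)
      ≡⟨ solve 3 (λ x y d → (x :+ d) :* (y :+ d) := x :* y :+ d :* (x :+ y :+ d)) refl x y d ⟩
    x * y + d * (x + y + d)
      ≤⟨ +-monoʳ-≤ (x * y) (*-monoʳ-≤′ (<⇒≤ 0<d)
           (+-monoʳ-≤ (x + y) (<⇒≤ (<-≤-trans d<z⊓1 (p⊓q≤q z 1ℚ))))) ⟩
    x * y + d * s
      <⟨ +-monoʳ-< (x * y) (*-monoˡ-<′ 0<s (<-≤-trans d<z⊓1 (p⊓q≤p z 1ℚ))) ⟩
    x * y + z * s
      ≡⟨ cong (_+_ (x * y)) zs ⟩
    x * y + (b - x * y)
      ≡⟨ solve 2 (λ c b → c :+ (b :- c) := b) refl (x * y) b ⟩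
    b ∎

^-⊓-bound : ∀ {b x y r} n → 0ℚ ≤ x ⊓ r → r ^ n < y → x * y < b →
            (x ⊓ r) ^ suc n < b
^-⊓-bound {b} {x} {y} {r} n 0≤u rⁿ<y xy<b = ≤-<-trans
  (*-mono-≤′ (≤-trans 0≤u (p⊓q≤p x r)) (^-nonNeg n 0≤u) (p⊓q≤p x r)
    (≤-trans (^-mono-≤ n 0≤u (p⊓q≤q x r)) (<⇒≤ rⁿ<y)))
  xy<b

^-openˡ : ∀ {q b} n → 0ℚ ≤ q → q ^ n < b → ∃ λ r → q < r × r ^ n < b
^-openˡ {q} zero 0≤q lt = q + 1ℚ , p<p+q q (positive⁻¹ 1ℚ) , lt
^-openˡ {q} {b} (suc n) 0≤q lt = step (*-openˡ 0≤q (^-nonNeg n 0≤q) lt)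
  where
  Goal = ∃ λ r → q < r × r ^ suc n < b

  step′ : ∀ {x y} → q < x → x * y < b → (∃ λ r → q < r × r ^ n < y) → Goal
  step′ {x} q<x xy<b (r , q<r , rⁿ<y) =
    x ⊓ r , q<u , ^-⊓-bound {x = x} n (≤-trans 0≤q (<⇒≤ q<u)) rⁿ<y xy<b
    where
    q<u : q < x ⊓ r
    q<u = <-⊓ q<x q<r

  step : (∃ λ d → 0ℚ < d × (q + d) * (q ^ n + d) < b) → Goal
  step (d , 0<d , lt′) = step′ (p<p+q q 0<d) lt′ (^-openˡ n 0≤q (p<p+q (q ^ n) 0<d))

*-openʳ : ∀ {x y b} → 0ℚ ≤ b → 0ℚ < y → b < x * y →
          ∃ λ x′ → 0ℚ < x′ × x′ < x × b < x′ * y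
*-openʳ {x} {y} {b} 0≤b 0<y b<xy =
  x′ , ≤-<-trans 0≤z z<x′ , x′<x , subst (_< x′ * y) zy (*-monoˡ-<′ 0<y z<x′)
  where
  z = proj₁ (quotient b 0<y)

  zy : z * y ≡ b
  zy = proj₂ (quotient b 0<y)

  z<x : z < x
  z<x = *-cancelʳ-<-nonNeg y {{nonNegative (<⇒≤ 0<y)}} (subst (_< x * y) (sym zy) b<xy)

  0≤z : 0ℚ ≤ z
  0≤z = *-cancelʳ-≤-pos y {{positive 0<y}}
    (subst₂ _≤_ (sym (*-zeroˡ y)) (sym zy) 0≤b)

  x′ = proj₁ (<-dense z<x)

  z<x′ : z < x′
  z<x′ = proj₁ (proj₂ (<-dense z<x))

  x′<x : x′ < x
  x′<x = proj₂ (proj₂ (<-dense z<x))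

^-⊔-bound : ∀ {b x y r} n → 0ℚ < x → 0ℚ < y → 0ℚ < r → y < r ^ n → b < y * x →
            b < (x ⊔ r) ^ suc n
^-⊔-bound {b} {x} {y} {r} n 0<x 0<y 0<r y<rⁿ b<yx = <-≤-trans
  (subst (b <_) (*-comm y x) b<yx)
  (*-mono-≤′ (≤-trans (<⇒≤ 0<x) (p≤p⊔q x r)) (<⇒≤ 0<y) (p≤p⊔q x r)
    (≤-trans (<⇒≤ y<rⁿ) (^-mono-≤ n (<⇒≤ 0<r) (p≤q⊔p x r))))

^-openʳ : ∀ {q b} n → 0ℚ ≤ b → 0ℚ < q → b < q ^ n →
          ∃ λ r → 0ℚ < r × r < q × b < r ^ n
^-openʳ {q} zero 0≤b 0<q lt = let (r , 0<r , r<q) = <-dense 0<q in r , 0<r , r<q , lt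
^-openʳ {q} {b} (suc n) 0≤b 0<q lt = step (*-openʳ 0≤b (^-pos n 0<q) lt)
  where
  Goal = ∃ λ r → 0ℚ < r × r < q × b < r ^ suc n

  step″ : ∀ {x y} → 0ℚ < x → x < q → 0ℚ < y → b < y * x →
          (∃ λ r → 0ℚ < r × r < q × y < r ^ n) → Goal
  step″ {x} 0<x x<q 0<y b<yx (r , 0<r , r<q , y<rⁿ) =
    x ⊔ r , <-≤-trans 0<x (p≤p⊔q x r) , ⊔-< x<q r<q , ^-⊔-bound n 0<x 0<y 0<r y<rⁿ b<yx

  step′ : ∀ {x} → 0ℚ < x → x < q →
          (∃ λ y → 0ℚ < y × y < q ^ n × b < y * x) → Goal
  step′ 0<x x<q (y , 0<y , y<qⁿ , b<yx) =
    step″ 0<x x<q 0<y b<yx (^-openʳ n (<⇒≤ 0<y) 0<q y<qⁿ)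

  step : (∃ λ x → 0ℚ < x × x < q × b < x * q ^ n) → Goal
  step (x , 0<x , x<q , b<xqⁿ) =
    step′ 0<x x<q (*-openʳ 0≤b 0<x (subst (b <_) (*-comm x (q ^ n)) b<xqⁿ))

1≤^ : ∀ {q} n → 1ℚ ≤ q → 1ℚ ≤ q ^ n
1≤^ zero    1≤q = ≤-refl
1≤^ (suc n) 1≤q = *-mono-≤′ (≤-trans (nonNegative⁻¹ 1ℚ) 1≤q) (nonNegative⁻¹ 1ℚ) 1≤q (1≤^ n 1≤q)

-- The non-negative real k-th root of a ≥ 0: a rational q lies below it
-- iff q < 0 or q ^ k < a, and above it iff 0 < q and a < q ^ k.
root : (k : ℕ) .{{_ : NonZero k}} (a : ℚ) .{{_ : NonNegative a}} → ℝ
root k@(suc k′) a = record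
  { L            = Lower
  ; U            = Upper
  ; L-inhabited  = - 1ℚ , inj₁ (negative⁻¹ (- 1ℚ))
  ; U-inhabited  = a + 1ℚ , 0<a+1 , (begin-strict
      a                            <⟨ a<a+1 ⟩
      a + 1ℚ                       ≡⟨ *-identityʳ (a + 1ℚ) ⟨
      (a + 1ℚ) * 1ℚ                ≤⟨ *-monoʳ-≤′ (<⇒≤ 0<a+1) (1≤^ k′ (+-monoˡ-≤ 1ℚ 0≤a)) ⟩
      (a + 1ℚ) * (a + 1ℚ) ^ k′     ∎)
  ; L-downClosed = down
  ; L-open       = open-L
  ; U-upClosed   = λ p<q (0<p , a<pᵏ) →
      <-trans 0<p p<q , <-trans a<pᵏ (^-mono-< k (<⇒≤ 0<p) p<q)
  ; U-open       = λ (0<q , a<qᵏ) →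
      let (r , 0<r , r<q , a<rᵏ) = ^-openʳ k 0≤a 0<q a<qᵏ in r , r<q , 0<r , a<rᵏ
  ; disjoint     = λ { (inj₁ q<0) (0<q , _) → <-asym q<0 0<q
                     ; (inj₂ qᵏ<a) (_ , a<qᵏ) → <-asym qᵏ<a a<qᵏ }
  ; located      = loc
  }
  where
  Lower Upper : ℚ → Set
  Lower q = q < 0ℚ ⊎ q ^ k < a
  Upper q = 0ℚ < q × a < q ^ k

  0≤a : 0ℚ ≤ a
  0≤a = nonNegative⁻¹ a

  a<a+1 : a < a + 1ℚ
  a<a+1 = p<p+q a (positive⁻¹ 1ℚ)

  0<a+1 : 0ℚ < a + 1ℚ
  0<a+1 = ≤-<-trans 0≤a a<a+1

  down : ∀ {p q} → p < q → Lower q → Lower p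
  down p<q (inj₁ q<0) = inj₁ (<-trans p<q q<0)
  down {p} p<q (inj₂ qᵏ<a) with p <? 0ℚ
  ... | yes p<0 = inj₁ p<0
  ... | no  p≮0 = inj₂ (<-trans (^-mono-< k (≮⇒≥ p≮0) p<q) qᵏ<a)

  open-L : ∀ {q} → Lower q → ∃ λ r → q < r × Lower r
  open-L (inj₁ q<0) = let (r , q<r , r<0) = <-dense q<0 in r , q<r , inj₁ r<0
  open-L {q} (inj₂ qᵏ<a) with q <? 0ℚ
  ... | yes q<0 = let (r , q<r , r<0) = <-dense q<0 in r , q<r , inj₁ r<0
  ... | no  q≮0 = let (r , q<r , rᵏ<a) = ^-openˡ k (≮⇒≥ q≮0) qᵏ<a in r , q<r , inj₂ rᵏ<a

  loc : ∀ {p q} → p < q → Lower p ⊎ Upper q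
  loc {p} p<q with p <? 0ℚ
  ... | yes p<0 = inj₁ (inj₁ p<0)
  ... | no  p≮0 with p ^ k <? a
  ...   | yes pᵏ<a = inj₁ (inj₂ pᵏ<a)
  ...   | no  pᵏ≮a = inj₂ (≤-<-trans (≮⇒≥ p≮0) p<q ,
                           ≤-<-trans (≮⇒≥ pᵏ≮a) (^-mono-< k (≮⇒≥ p≮0) p<q))

fromℕ : ℕ → ℚ
fromℕ a = + a / 1

-- f(m,n)^{1/((m+1)(n+1))}
normalizedCount : ℕ → ℕ → ℝ
normalizedCount m n = root (suc m ℕ.* suc n) (fromℕ (f m n)) {{normalize-nonNeg (f m n) 1}}

{-# OPTIONS --safe #-}
-- F a b, the number of independent sets of the a × b king's graph, is an
-- entry of a power of a symmetric 0-1 matrix.  It is symmetric in a and b,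
-- submultiplicative in a, and F a b · F a′ b ≤ F (a + a′ + 1) b, since
-- an empty row may be inserted.  Hence F a b ^ (1 / (a + 1)(b + 1)) ≤
-- F c d ^ (1 / c d), and η is the cut separating the rationals below one
-- of the left sides from those above one of the right sides.
--
-- Upper bound: for the transfer matrix T of rows of length b,
-- |T⁶ x|² ≤ tr T¹² · |x|², and tr T¹² counts the independent sets on a
-- cylinder of circumference 12, so that η¹² is at most the growth rate in
-- b of that count.  Lower bound: by Cauchy–Schwarz F (2k + 1) b is
-- log-convex in k, so η² is at least the quotient of the growth rates of
-- the strips of widths 13 and 11.  Both rates are bounded by comparing two
-- consecutive vectors of the power iteration.
module Submission where

open import Algebra.Bundles using (CommutativeRing)
open import Data.Empty using (⊥-elim)
open import Data.Nat.Base as ℕ using (ℕ; zero; suc; NonZero)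
import Data.Nat.Properties as ℕ
open import Data.Nat.Tactic.RingSolver using (solve-∀)
open import Data.Product.Base using (∃; _×_; _,_)
open import Data.Sum.Base using (_⊎_; inj₁; inj₂)
open import Data.Unit.Base using (tt)
open import Relation.Binary.PropositionalEquality
  using (_≡_; refl; sym; trans; cong; cong₂; subst; subst₂; module ≡-Reasoning)
open import Relation.Nullary.Decidable using (Dec; yes; no; toWitness)

-- No eigenvalue is ever formed. A bound on a growth rate is an inequality of natural numbers such
-- as `α ^ j * F (j + k) n ≤ β ^ j * F k n` for all `j`. It follows from a single entrywise
-- inequality between two vectors, because multiplication by a non-negative matrix preserves it (the
-- Collatz-Wielandt bound), and that inequality is decided by evaluation.
--
-- The exponents (a + 1)(b + 1) and c d differ only by a boundary term that is negligible for large
-- rectangles. This makes the cut located, so that the existence of the limit needs no separate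
-- subadditivity lemma.
--
-- The parities are forced by Cauchy-Schwarz. It relates diagonal entries of even powers of T:
-- `F (2k + 1) b` is such an entry of T to the power 2k + 2, which is why the widths 11 and 13 are
-- odd, and the trace is that of an even power, which is why the circumference 12 is even.

module Counting where

  open import Data.Nat.Properties
  open import Algebra.Properties.CommutativeSemigroup *-commutativeSemigroup using (interchange; x∙yz≈y∙xz; x∙yz≈yx∙z)
  open import Algebra.Properties.CommutativeSemigroup +-commutativeSemigroup
    using () renaming (interchange to +-interchange)
  open import Data.Bool.Base using (Bool; true; false; _∧_; T)
  open import Data.Bool.Properties using (T-∧)
  open import Data.Fin.Base using (Fin; zero; suc; toℕ; inject₁)
  import Data.Fin.Properties as Fin
  open import Data.List.Base using (List; []; _∷_; _++_; map; cartesianProductWith; filter; length)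
  open import Data.List.Membership.Propositional using () renaming (_∈_ to _∈ᴸ_)
  open import Data.List.Membership.Propositional.Properties using (∈-cartesianProductWith⁺)
  open import Data.List.Properties using (map-cong; map-++; map-∘)
  open import Data.List.Relation.Unary.Any using (here; there)
  open import Data.Nat.Base using (_+_; _*_; _≤_; _≤ᵇ_; _^_; ∣_-_∣; z≤n; s≤s; >-nonZero)
  open import Data.Nat.ListAction using (sum)
  open import Data.Nat.ListAction.Properties using (sum-++)
  open import Data.Product.Base using (∃₂; proj₁; proj₂)
  open import Data.Product.Function.NonDependent.Propositional using (_×-⇔_)
  open import Data.Product.Properties using (≡-dec; ,-injective)
  open import Data.Vec.Base using (Vec; []; _∷_; _∷ʳ_; zipWith; replicate; lookup)
  open import Data.Vec.Properties using ([]=⇒lookup; lookup⇒[]=; lookup-replicate)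
  open import Defs using (vectors; VertexSet; vertexSets; Independent; independent?; f)
  open import Function.Base using (_∘_; flip)
  open import Function.Bundles using (_⇔_; mk⇔; Equivalence)
  open import Function.Properties.Equivalence using (⇔-isEquivalence)
  open import Level using (0ℓ)
  open import Relation.Binary.Structures using (IsEquivalence)
  open import Relation.Nullary.Negation using (¬_)
  open import Relation.Unary using (Decidable)

  -- Sums over lists

  ∑ : {A : Set} → List A → (A → ℕ) → ℕ
  ∑ xs g = sum (map g xs)

  ∑-cong : {A : Set} {g h : A → ℕ} (xs : List A) → (∀ x → g x ≡ h x) → ∑ xs g ≡ ∑ xs h
  ∑-cong xs g≗h = cong sum (map-cong g≗h xs)

  ∑-mono : {A : Set} {g h : A → ℕ} (xs : List A) → (∀ x → g x ≤ h x) → ∑ xs g ≤ ∑ xs h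
  ∑-mono []       g≤h = z≤n
  ∑-mono (x ∷ xs) g≤h = +-mono-≤ (g≤h x) (∑-mono xs g≤h)

  ∑-zero : {A : Set} (xs : List A) → ∑ xs (λ _ → 0) ≡ 0
  ∑-zero []       = refl
  ∑-zero (_ ∷ xs) = ∑-zero xs

  ∑-+ : {A : Set} (xs : List A) (g h : A → ℕ) → ∑ xs (λ x → g x + h x) ≡ ∑ xs g + ∑ xs h
  ∑-+ []       g h = refl
  ∑-+ (x ∷ xs) g h = trans (cong (g x + h x +_) (∑-+ xs g h))
    (+-interchange (g x) (h x) (∑ xs g) (∑ xs h))

  ∑-*ˡ : {A : Set} (xs : List A) (c : ℕ) (g : A → ℕ) → ∑ xs (λ x → c * g x) ≡ c * ∑ xs g
  ∑-*ˡ []       c g = sym (*-zeroʳ c)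
  ∑-*ˡ (x ∷ xs) c g = trans (cong (c * g x +_) (∑-*ˡ xs c g)) (sym (*-distribˡ-+ c (g x) (∑ xs g)))

  ∑-*ʳ : {A : Set} (xs : List A) (g : A → ℕ) (c : ℕ) → ∑ xs (λ x → g x * c) ≡ ∑ xs g * c
  ∑-*ʳ xs g c = trans (∑-cong xs (λ x → *-comm (g x) c)) (trans (∑-*ˡ xs c g) (*-comm c (∑ xs g)))

  ∑-swap : {A B : Set} (xs : List A) (ys : List B) (g : A → B → ℕ) →
           ∑ xs (λ x → ∑ ys (λ y → g x y)) ≡ ∑ ys (λ y → ∑ xs (λ x → g x y))
  ∑-swap []       ys g = sym (∑-zero ys)
  ∑-swap (x ∷ xs) ys g = trans (cong (∑ ys (g x) +_) (∑-swap xs ys g))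
    (sym (∑-+ ys (g x) (λ y → ∑ xs (λ x′ → g x′ y))))

  ∑-++ : {A : Set} (xs ys : List A) (g : A → ℕ) → ∑ (xs ++ ys) g ≡ ∑ xs g + ∑ ys g
  ∑-++ xs ys g = trans (cong sum (map-++ g xs ys)) (sum-++ (map g xs) (map g ys))

  ∑-cartesianProductWith : {A B C : Set} (_∙_ : A → B → C) (xs : List A) (ys : List B) (g : C → ℕ) →
    ∑ (cartesianProductWith _∙_ xs ys) g ≡ ∑ xs (λ x → ∑ ys (λ y → g (x ∙ y)))
  ∑-cartesianProductWith _∙_ []       ys g = refl
  ∑-cartesianProductWith _∙_ (x ∷ xs) ys g = trans (∑-++ (map (x ∙_) ys) _ g)
    (cong₂ _+_ (cong sum (sym (map-∘ ys))) (∑-cartesianProductWith _∙_ xs ys g))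

  ∑-vectors-suc : {A : Set} (xs : List A) (n : ℕ) (g : Vec A (suc n) → ℕ) →
    ∑ (vectors xs (suc n)) g ≡ ∑ xs (λ x → ∑ (vectors xs n) (λ v → g (x ∷ v)))
  ∑-vectors-suc xs n = ∑-cartesianProductWith _∷_ xs (vectors xs n)

  -- Induction on the rows: the sum over the rest of the first row is exchanged with the sum over
  -- the rest of the first column. This is the step that turns sums by rows into sums by columns.
  ∑-vectors-zipWith : {A : Set} (xs : List A) (m n : ℕ) (g : Vec (Vec A (suc n)) m → ℕ) →
    ∑ (vectors (vectors xs (suc n)) m) g ≡
    ∑ (vectors xs m) (λ c → ∑ (vectors (vectors xs n) m) (λ S → g (zipWith _∷_ c S)))
  ∑-vectors-zipWith xs zero    n g = cong (_+ 0) (sym (+-identityʳ (g [])))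
  ∑-vectors-zipWith xs (suc m) n g = begin
    ∑ (vectors Rs⁺ (suc m)) g
      ≡⟨ ∑-vectors-suc Rs⁺ m g ⟩
    ∑ Rs⁺ (λ r → ∑ (vectors Rs⁺ m) (λ S → g (r ∷ S)))
      ≡⟨ ∑-cong Rs⁺ (λ r → ∑-vectors-zipWith xs m n (λ S → g (r ∷ S))) ⟩
    ∑ Rs⁺ (λ r → ∑ Cs (λ c → ∑ (vectors Rs m) (λ S → g (r ∷ zipWith _∷_ c S))))
      ≡⟨ ∑-vectors-suc xs n _ ⟩
    ∑ xs (λ x → ∑ Rs (λ r → ∑ Cs (λ c → ∑ (vectors Rs m) (λ S → g ((x ∷ r) ∷ zipWith _∷_ c S)))))
      ≡⟨ ∑-cong xs (λ x → ∑-swap Rs Cs _) ⟩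
    ∑ xs (λ x → ∑ Cs (λ c → ∑ Rs (λ r → ∑ (vectors Rs m) (λ S → g ((x ∷ r) ∷ zipWith _∷_ c S)))))
      ≡⟨ ∑-cong xs (λ x → ∑-cong Cs (λ c → ∑-vectors-suc Rs m (λ S → g (zipWith _∷_ (x ∷ c) S)))) ⟨
    ∑ xs (λ x → ∑ Cs (λ c → ∑ (vectors Rs (suc m)) (λ S → g (zipWith _∷_ (x ∷ c) S))))
      ≡⟨ ∑-vectors-suc xs m _ ⟨
    ∑ (vectors xs (suc m)) (λ c → ∑ (vectors Rs (suc m)) (λ S → g (zipWith _∷_ c S))) ∎
    where
    open ≡-Reasoning
    Rs = vectors xs n
    Rs⁺ = vectors xs (suc n)
    Cs = vectors xs m

  ∑-vectors-replicate : {A : Set} (x : A) (n : ℕ) (g : Vec A n → ℕ) →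
    ∑ (vectors (x ∷ []) n) g ≡ g (replicate n x)
  ∑-vectors-replicate x zero    g = +-identityʳ (g [])
  ∑-vectors-replicate x (suc n) g = trans (∑-vectors-suc (x ∷ []) n g)
    (trans (+-identityʳ _) (∑-vectors-replicate x n (λ v → g (x ∷ v))))

  term≤∑ : {A : Set} {x : A} {xs : List A} (g : A → ℕ) → x ∈ᴸ xs → g x ≤ ∑ xs g
  term≤∑ g (here refl) = m≤m+n _ _
  term≤∑ g (there x∈)  = ≤-trans (term≤∑ g x∈) (m≤n+m _ _)

  -- Cauchy-Schwarz over the natural numbers

  *-self-cancel-≤ : ∀ {x y} → x * x ≤ y * y → x ≤ y
  *-self-cancel-≤ {x} {y} xx≤yy with x ≤? y
  ... | yes x≤y = x≤y
  ... | no  x≰y with () ← <⇒≱ (*-mono-< (≰⇒> x≰y) (≰⇒> x≰y)) xx≤yy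

  x≤y⇒4xy≤[x+y]² : ∀ {x y} → x ≤ y → 4 * (x * y) ≤ (x + y) * (x + y)
  x≤y⇒4xy≤[x+y]² {x} x≤y with d , refl ← m≤n⇒∃[o]m+o≡n x≤y =
    subst (4 * (x * (x + d)) ≤_) (expand x d) (m≤m+n _ (d * d))
    where
    expand : ∀ x d → 4 * (x * (x + d)) + d * d ≡ (x + (x + d)) * (x + (x + d))
    expand = solve-∀

  4xy≤[x+y]² : ∀ x y → 4 * (x * y) ≤ (x + y) * (x + y)
  4xy≤[x+y]² x y with ≤-total x y
  ... | inj₁ x≤y = x≤y⇒4xy≤[x+y]² x≤y
  ... | inj₂ y≤x rewrite *-comm x y | +-comm x y = x≤y⇒4xy≤[x+y]² y≤x

  -- The cross term 2abS is at most a²B + b²A, because its square is at most 4(a²B)(b²A) and the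
  -- arithmetic-geometric mean inequality applies. Comparing squares avoids roots.
  cauchySchwarz-step : ∀ a b S A B → S * S ≤ A * B →
    (a * b + S) * (a * b + S) ≤ (a * a + A) * (b * b + B)
  cauchySchwarz-step a b S A B SS≤AB = subst₂ _≤_ (eq₁ a b S) (eq₂ a b A B)
    (+-mono-≤ (≤-refl {(a * b) * (a * b)}) (+-mono-≤ cross SS≤AB))
    where
    open ≤-Reasoning
    eq₁ : ∀ a b S → (a * b) * (a * b) + (2 * (a * b) * S + S * S) ≡ (a * b + S) * (a * b + S)
    eq₁ = solve-∀
    eq₂ : ∀ a b A B → (a * b) * (a * b) + ((a * a * B + b * b * A) + A * B) ≡ (a * a + A) * (b * b + B)
    eq₂ = solve-∀
    eq₃ : ∀ a b S → (2 * (a * b) * S) * (2 * (a * b) * S) ≡ 4 * ((a * b) * (a * b)) * (S * S)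
    eq₃ = solve-∀
    eq₄ : ∀ a b A B → 4 * ((a * b) * (a * b)) * (A * B) ≡ 4 * ((a * a * B) * (b * b * A))
    eq₄ = solve-∀
    cross : 2 * (a * b) * S ≤ a * a * B + b * b * A
    cross = *-self-cancel-≤ (begin
      (2 * (a * b) * S) * (2 * (a * b) * S)                    ≡⟨ eq₃ a b S ⟩
      4 * ((a * b) * (a * b)) * (S * S)                        ≤⟨ *-monoʳ-≤ (4 * ((a * b) * (a * b))) SS≤AB ⟩
      4 * ((a * b) * (a * b)) * (A * B)                        ≡⟨ eq₄ a b A B ⟩
      4 * ((a * a * B) * (b * b * A))                          ≤⟨ 4xy≤[x+y]² (a * a * B) (b * b * A) ⟩
      (a * a * B + b * b * A) * (a * a * B + b * b * A)        ∎)

  cauchySchwarz : {A : Set} (xs : List A) (g h : A → ℕ) →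
    ∑ xs (λ x → g x * h x) * ∑ xs (λ x → g x * h x) ≤
    ∑ xs (λ x → g x * g x) * ∑ xs (λ x → h x * h x)
  cauchySchwarz []       g h = z≤n
  cauchySchwarz (x ∷ xs) g h = cauchySchwarz-step (g x) (h x) _ _ _ (cauchySchwarz xs g h)

  -- Symmetric transfer matrices

  -- walks m u v is the entry at (u , v) of the power T ^ (m + 1).
  module Transfer {A : Set} (xs : List A) (T : A → A → ℕ) where

    walks : ℕ → A → A → ℕ
    walks zero    u v = T u v
    walks (suc m) u v = ∑ xs (λ w → T u w * walks m w v)

    weight : ∀ {m} → A → Vec A m → A → ℕ
    weight u []      v = T u v
    weight u (w ∷ S) v = T u w * weight w S v

    walks-∑ : ∀ m u v → walks m u v ≡ ∑ (vectors xs m) (λ S → weight u S v)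
    walks-∑ zero    u v = sym (+-identityʳ (T u v))
    walks-∑ (suc m) u v = begin
      ∑ xs (λ w → T u w * walks m w v)
        ≡⟨ ∑-cong xs (λ w → cong (T u w *_) (walks-∑ m w v)) ⟩
      ∑ xs (λ w → T u w * ∑ (vectors xs m) (λ S → weight w S v))
        ≡⟨ ∑-cong xs (λ w → ∑-*ˡ (vectors xs m) (T u w) (λ S → weight w S v)) ⟨
      ∑ xs (λ w → ∑ (vectors xs m) (λ S → weight u (w ∷ S) v))
        ≡⟨ ∑-vectors-suc xs m (λ S → weight u S v) ⟨
      ∑ (vectors xs (suc m)) (λ S → weight u S v) ∎
      where open ≡-Reasoning

    walks-compose : ∀ m n u v → walks (m + suc n) u v ≡ ∑ xs (λ w → walks m u w * walks n w v)
    walks-compose zero    n u v = refl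
    walks-compose (suc m) n u v = begin
      ∑ xs (λ w → T u w * walks (m + suc n) w v)
        ≡⟨ ∑-cong xs (λ w → cong (T u w *_) (walks-compose m n w v)) ⟩
      ∑ xs (λ w → T u w * ∑ xs (λ x → walks m w x * walks n x v))
        ≡⟨ ∑-cong xs (λ w → ∑-*ˡ xs (T u w) _) ⟨
      ∑ xs (λ w → ∑ xs (λ x → T u w * (walks m w x * walks n x v)))
        ≡⟨ ∑-swap xs xs _ ⟩
      ∑ xs (λ x → ∑ xs (λ w → T u w * (walks m w x * walks n x v)))
        ≡⟨ ∑-cong xs (λ x → ∑-cong xs (λ w → *-assoc (T u w) (walks m w x) (walks n x v))) ⟨
      ∑ xs (λ x → ∑ xs (λ w → T u w * walks m w x * walks n x v))
        ≡⟨ ∑-cong xs (λ x → ∑-*ʳ xs _ (walks n x v)) ⟩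
      ∑ xs (λ x → walks (suc m) u x * walks n x v) ∎
      where open ≡-Reasoning

    module Symmetric (T-sym : ∀ u v → T u v ≡ T v u) where

      walks-sym : ∀ m u v → walks m u v ≡ walks m v u
      walks-sym zero    u v = T-sym u v
      walks-sym (suc m) u v = begin
        ∑ xs (λ w → T u w * walks m w v)
          ≡⟨ ∑-cong xs (λ w → trans (*-comm (T u w) _) (cong₂ _*_ (walks-sym m w v) (T-sym u w))) ⟩
        ∑ xs (λ w → walks m v w * T w u)     ≡⟨ walks-compose m zero v u ⟨
        walks (m + 1) v u                    ≡⟨ cong (λ k → walks k v u) (+-comm m 1) ⟩
        walks (suc m) v u                    ∎
        where open ≡-Reasoning

      walks-product : ∀ m n u → walks (m + suc n) u u ≡ ∑ xs (λ w → walks m u w * walks n u w)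
      walks-product m n u = trans (walks-compose m n u u)
        (∑-cong xs (λ w → cong (walks m u w *_) (walks-sym n w u)))

      -- By symmetry, scalar products of the rows at `u` of two powers of T are diagonal entries at
      -- `u`, so this is Cauchy-Schwarz for these rows.
      walks-logConvex : ∀ m n u → walks (m + suc n) u u * walks (m + suc n) u u ≤
                                  walks (m + suc m) u u * walks (n + suc n) u u
      walks-logConvex m n u
        rewrite walks-product m n u | walks-product m m u | walks-product n n u =
        cauchySchwarz xs (walks m u) (walks n u)

      trace : ℕ → ℕ
      trace m = ∑ xs (λ u → walks m u u)

      -- The left side is the squared norm of row `u` of a power of T. Each entry, at `v`, is a
      -- scalar product of row `u` of one power with row `v` of another; Cauchy-Schwarz separates
      -- `u` from `v`, and the sum over `v` becomes a trace.
      walks≤trace : ∀ m n u → walks (m + suc n + suc (m + suc n)) u u ≤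
                              walks (m + suc m) u u * trace (n + suc n)
      walks≤trace m n u = begin
        walks (m + suc n + suc (m + suc n)) u u
          ≡⟨ walks-product (m + suc n) (m + suc n) u ⟩
        ∑ xs (λ v → walks (m + suc n) u v * walks (m + suc n) u v)
          ≤⟨ ∑-mono xs row ⟩
        ∑ xs (λ v → walks (m + suc m) u u * walks (n + suc n) v v)
          ≡⟨ ∑-*ˡ xs (walks (m + suc m) u u) (λ v → walks (n + suc n) v v) ⟩
        walks (m + suc m) u u * trace (n + suc n) ∎
        where
        open ≤-Reasoning
        row : ∀ v → walks (m + suc n) u v * walks (m + suc n) u v ≤
                    walks (m + suc m) u u * walks (n + suc n) v v
        row v rewrite walks-compose m n u v | walks-product m m u | walks-product n n v
                    | ∑-cong xs (λ w → cong (walks m u w *_) (walks-sym n w v)) =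
          cauchySchwarz xs (walks m u) (walks n v)

    -- Here `o` stands for the empty row, so `T u o * T o v` asks `u` and `v` to be admissible
    -- separately. `T-split` says that dropping the interaction of two rows only adds
    -- configurations.
    module Vacuum (o : A) (o∈xs : o ∈ᴸ xs) (T-oo : T o o ≡ 1)
                  (T-split : ∀ u v → T u v ≤ T u o * T o v) where

      walks-split : ∀ m u v → walks m u v ≤ walks m u o * T o v
      walks-split zero    u v = T-split u v
      walks-split (suc m) u v = begin
        ∑ xs (λ w → T u w * walks m w v)
          ≤⟨ ∑-mono xs (λ w → *-monoʳ-≤ (T u w) (walks-split m w v)) ⟩
        ∑ xs (λ w → T u w * (walks m w o * T o v))
          ≡⟨ ∑-cong xs (λ w → *-assoc (T u w) (walks m w o) (T o v)) ⟨
        ∑ xs (λ w → T u w * walks m w o * T o v)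
          ≡⟨ ∑-*ʳ xs _ (T o v) ⟩
        walks (suc m) u o * T o v ∎
        where open ≤-Reasoning

      walks-submultiplicative : ∀ m n → walks (m + n) o o ≤ walks m o o * walks n o o
      walks-submultiplicative m zero rewrite +-identityʳ m | T-oo = ≤-reflexive (sym (*-identityʳ _))
      walks-submultiplicative m (suc n) = begin
        walks (m + suc n) o o
          ≡⟨ walks-compose m n o o ⟩
        ∑ xs (λ w → walks m o w * walks n w o)
          ≤⟨ ∑-mono xs (λ w → *-monoˡ-≤ (walks n w o) (walks-split m o w)) ⟩
        ∑ xs (λ w → walks m o o * T o w * walks n w o)
          ≡⟨ ∑-cong xs (λ w → *-assoc (walks m o o) (T o w) (walks n w o)) ⟩
        ∑ xs (λ w → walks m o o * (T o w * walks n w o))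
          ≡⟨ ∑-*ˡ xs (walks m o o) (λ w → T o w * walks n w o) ⟩
        walks m o o * walks (suc n) o o ∎
        where open ≤-Reasoning

      walks-supermultiplicative : ∀ m n → walks m o o * walks n o o ≤ walks (m + suc n) o o
      walks-supermultiplicative m n = subst (walks m o o * walks n o o ≤_) (sym (walks-compose m n o o))
        (term≤∑ (λ w → walks m o w * walks n w o) o∈xs)

  -- The king's graph

  bits : List Bool
  bits = false ∷ true ∷ []

  rows : (n : ℕ) → List (Vec Bool n)
  rows = vectors bits

  -- 1 if the 2 × 2 square with rows a b and c d has at most one vertex, else 0.
  block : (a b c d : Bool) → ℕ
  block true  false false false = 1
  block false true  false false = 1
  block false false true  false = 1
  block false false false _     = 1
  block _     _     _     _     = 0

  -- The 2 × (n + 2) array with rows a u b and a′ u′ b′.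
  ladder : ∀ {n} (a : Bool) (u : Vec Bool n) (b : Bool) (a′ : Bool) (u′ : Vec Bool n) (b′ : Bool) → ℕ
  ladder a []      b a′ []        b′ = block a b a′ b′
  ladder a (x ∷ u) b a′ (x′ ∷ u′) b′ = block a x a′ x′ * ladder x u b x′ u′ b′

  rowT : ∀ {n} → Vec Bool n → Vec Bool n → ℕ
  rowT u u′ = ladder false u false false u′ false

  -- Wrapping the first entry around to the end makes the line a cycle.
  ringT : ∀ {n} → Vec Bool (suc n) → Vec Bool (suc n) → ℕ
  ringT (a ∷ u) (a′ ∷ u′) = ladder a u a a′ u′ a′

  zeros : ∀ n → Vec Bool n
  zeros n = replicate n false

  ∀Bool : {P : Bool → Set} → P false → P true → ∀ b → P b
  ∀Bool pf pt false = pf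
  ∀Bool pf pt true  = pt

  block-≤1 : ∀ a b c d → block a b c d ≤ 1
  block-≤1 true  true  _     _     = z≤n
  block-≤1 true  false true  _     = z≤n
  block-≤1 true  false false true  = z≤n
  block-≤1 true  false false false = ≤-refl
  block-≤1 false true  true  _     = z≤n
  block-≤1 false true  false true  = z≤n
  block-≤1 false true  false false = ≤-refl
  block-≤1 false false true  true  = z≤n
  block-≤1 false false true  false = ≤-refl
  block-≤1 false false false _     = ≤-refl

  block-transpose : ∀ a b c d → block a b c d ≡ block a c b d
  block-transpose = ∀Bool
    (∀Bool (∀Bool (λ _ → refl) (∀Bool refl refl)) (∀Bool (∀Bool refl refl) (λ _ → refl)))
    (∀Bool (∀Bool (λ _ → refl) (λ _ → refl)) (∀Bool (λ _ → refl) (λ _ → refl)))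

  block-flip : ∀ a b c d → block a b c d ≡ block c d a b
  block-flip = ∀Bool
    (∀Bool (∀Bool (∀Bool refl refl) (∀Bool refl refl)) (∀Bool (∀Bool refl refl) (∀Bool refl refl)))
    (∀Bool (∀Bool (∀Bool refl refl) (∀Bool refl refl)) (∀Bool (∀Bool refl refl) (∀Bool refl refl)))

  block-split : ∀ a b c d → block a b c d ≤ block a b false false * block false false c d
  block-split true  true  _     _     = z≤n
  block-split true  false true  _     = z≤n
  block-split true  false false true  = z≤n
  block-split true  false false false = ≤-refl
  block-split false true  true  _     = z≤n
  block-split false true  false true  = z≤n
  block-split false true  false false = ≤-refl
  block-split false false true  true  = z≤n
  block-split false false true  false = ≤-refl
  block-split false false false false = ≤-refl
  block-split false false false true  = ≤-refl

  ladder-≤1 : ∀ {n} a (u : Vec Bool n) b a′ u′ b′ → ladder a u b a′ u′ b′ ≤ 1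
  ladder-≤1 a []      b a′ []        b′ = block-≤1 a b a′ b′
  ladder-≤1 a (x ∷ u) b a′ (x′ ∷ u′) b′ =
    *-mono-≤ (block-≤1 a x a′ x′) (ladder-≤1 x u b x′ u′ b′)

  ladder-flip : ∀ {n} a (u : Vec Bool n) b a′ u′ b′ →
                ladder a u b a′ u′ b′ ≡ ladder a′ u′ b′ a u b
  ladder-flip a []      b a′ []        b′ = block-flip a b a′ b′
  ladder-flip a (x ∷ u) b a′ (x′ ∷ u′) b′ =
    cong₂ _*_ (block-flip a x a′ x′) (ladder-flip x u b x′ u′ b′)

  ladder-split : ∀ {n} a (u : Vec Bool n) b a′ u′ b′ → ladder a u b a′ u′ b′ ≤
    ladder a u b false (zeros n) false * ladder false (zeros n) false a′ u′ b′
  ladder-split a []      b a′ []        b′ = block-split a b a′ b′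
  ladder-split a (x ∷ u) b a′ (x′ ∷ u′) b′ =
    ≤-trans (*-mono-≤ (block-split a x a′ x′) (ladder-split x u b x′ u′ b′))
      (≤-reflexive (interchange (block a x false false) _ _ _))

  rowT-zeros : ∀ n → rowT (zeros n) (zeros n) ≡ 1
  rowT-zeros zero    = refl
  rowT-zeros (suc n) = trans (+-identityʳ _) (rowT-zeros n)

  zeros∈rows : ∀ n → zeros n ∈ᴸ rows n
  zeros∈rows zero    = here refl
  zeros∈rows (suc n) = ∈-cartesianProductWith⁺ _∷_ {xs = bits} {ys = rows n} (here refl) (zeros∈rows n)

  module Row (n : ℕ) where
    open Transfer (rows n) rowT public
    open Symmetric (λ u v → ladder-flip false u false false v false) public
    open Vacuum (zeros n) (zeros∈rows n) (rowT-zeros n)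
      (λ u v → ladder-split false u false false v false) public

  module Ring (n : ℕ) = Transfer (rows (suc n)) ringT

  -- The independent sets of the a × b king's graph, counted as walks
  -- between two additional empty rows.
  F : ℕ → ℕ → ℕ
  F a b = Row.walks b a (zeros b) (zeros b)

  -- The transfer weight of the row sequence r , S , e when each row is
  -- preceded by the entry of the column x , c , z in that row.  Peeling off
  -- one column after another exchanges the roles of rows and columns.
  sheet : ∀ {m n} (x : Bool) (c : Vec Bool m) (z : Bool) →
          Vec Bool n → Vec (Vec Bool n) m → Vec Bool n → ℕ
  sheet x []      z r []      e = ladder x r false z e false
  sheet x (y ∷ c) z r (s ∷ S) e = ladder x r false y s false * sheet y c z s S e

  -- The 2 × 2 squares across the first two columns, read transposed, are the squares of a ladder
  -- between these columns; all other squares form the remaining sheet.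
  sheet-peel : ∀ {m n} x (c : Vec Bool m) z x′ (r : Vec Bool n) c′ S z′ e →
    sheet x c z (x′ ∷ r) (zipWith _∷_ c′ S) (z′ ∷ e) ≡ ladder x c z x′ c′ z′ * sheet x′ c′ z′ r S e
  sheet-peel x []      z x′ r []        []      z′ e =
    cong (_* ladder x′ r false z′ e false) (block-transpose x x′ z z′)
  sheet-peel x (y ∷ c) z x′ r (y′ ∷ c′) (s ∷ S) z′ e
    rewrite sheet-peel y c z y′ s c′ S z′ e | block-transpose x x′ y y′ =
    interchange (block x y x′ y′) _ _ _

  sheet-empty : ∀ {m} x (c : Vec Bool m) z →
    sheet x c z [] (replicate m []) [] ≡ ladder x c z false (zeros m) false
  sheet-empty x []      z = block-transpose x false z false
  sheet-empty x (y ∷ c) z = cong₂ _*_ (block-transpose x false y false) (sheet-empty y c z)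

  sheet-zeros : ∀ {m n} (r : Vec Bool n) (S : Vec (Vec Bool n) m) e →
    sheet false (zeros m) false r S e ≡ Row.weight n r S e
  sheet-zeros r []      e = refl
  sheet-zeros r (s ∷ S) e = cong (rowT r s *_) (sheet-zeros s S e)

  ∑-sheet-peel : ∀ {m} n x (c : Vec Bool m) z x′ (r : Vec Bool n) z′ e →
    ∑ (vectors (rows (suc n)) m) (λ S → sheet x c z (x′ ∷ r) S (z′ ∷ e)) ≡
    ∑ (rows m) (λ c′ → ladder x c z x′ c′ z′ * ∑ (vectors (rows n) m) (λ S → sheet x′ c′ z′ r S e))
  ∑-sheet-peel {m} n x c z x′ r z′ e = trans (∑-vectors-zipWith bits m n _)
    (∑-cong (rows m) (λ c′ → trans
      (∑-cong (vectors (rows n) m) (λ S → sheet-peel x c z x′ r c′ S z′ e))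
      (∑-*ˡ (vectors (rows n) m) (ladder x c z x′ c′ z′) (λ S → sheet x′ c′ z′ r S e))))

  -- Peeling every column turns the sum over row sequences into a walk of columns. The `false` ends
  -- of the rows supply the empty column at which the walk stops.
  ∑-sheet-row : ∀ {m} n (c : Vec Bool m) →
    ∑ (vectors (rows n) m) (λ S → sheet false c false (zeros n) S (zeros n)) ≡
    Row.walks m n c (zeros m)
  ∑-sheet-row {m} zero    c = trans (∑-vectors-replicate [] m _) (sheet-empty false c false)
  ∑-sheet-row {m} (suc n) c = trans (∑-sheet-peel n false c false false (zeros n) false (zeros n))
    (∑-cong (rows m) (λ c′ → cong (rowT c c′ *_) (∑-sheet-row n c′)))

  F-∑ : ∀ a b → F a b ≡
    ∑ (vectors (rows b) a) (λ S → Row.weight b (zeros b) S (zeros b))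
  F-∑ a b = Row.walks-∑ b a (zeros b) (zeros b)

  F-sym : ∀ a b → F a b ≡ F b a
  F-sym a b = begin
    F a b
      ≡⟨ F-∑ a b ⟩
    ∑ (vectors (rows b) a) (λ S → Row.weight b (zeros b) S (zeros b))
      ≡⟨ ∑-cong (vectors (rows b) a) (λ S → sheet-zeros (zeros b) S (zeros b)) ⟨
    ∑ (vectors (rows b) a) (λ S → sheet false (zeros a) false (zeros b) S (zeros b))
      ≡⟨ ∑-sheet-row b (zeros a) ⟩
    F b a ∎
    where open ≡-Reasoning

  -- The top and bottom rows are the same `r`, so each peeled column has equal ends and closes up to
  -- a ring.
  ∑-sheet-ring : ∀ {m} n x (c : Vec Bool m) →
    ∑ (rows n) (λ r → ∑ (vectors (rows n) m) (λ S → sheet x c x r S r)) ≡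
    Ring.walks m n (x ∷ c) (zeros (suc m))
  ∑-sheet-ring {m} zero    x c =
    trans (+-identityʳ _) (trans (∑-vectors-replicate [] m _) (sheet-empty x c x))
  ∑-sheet-ring {m} (suc n) x c = begin
    ∑ (rows (suc n)) (λ r → ∑ (vectors (rows (suc n)) m) (λ S → sheet x c x r S r))
      ≡⟨ ∑-vectors-suc bits n _ ⟩
    ∑ bits (λ x′ → ∑ (rows n) (λ r → ∑ (vectors (rows (suc n)) m) (λ S → sheet x c x (x′ ∷ r) S (x′ ∷ r))))
      ≡⟨ ∑-cong bits (λ x′ → ∑-cong (rows n) (λ r → ∑-sheet-peel n x c x x′ r x′ r)) ⟩
    ∑ bits (λ x′ → ∑ (rows n) (λ r → ∑ (rows m) (λ c′ → ladder x c x x′ c′ x′ *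
      ∑ (vectors (rows n) m) (λ S → sheet x′ c′ x′ r S r))))
      ≡⟨ ∑-cong bits (λ x′ → ∑-swap (rows n) (rows m) (λ r c′ → ladder x c x x′ c′ x′ *
           ∑ (vectors (rows n) m) (λ S → sheet x′ c′ x′ r S r))) ⟩
    ∑ bits (λ x′ → ∑ (rows m) (λ c′ → ∑ (rows n) (λ r → ladder x c x x′ c′ x′ *
      ∑ (vectors (rows n) m) (λ S → sheet x′ c′ x′ r S r))))
      ≡⟨ ∑-cong bits (λ x′ → ∑-cong (rows m) (λ c′ → 
           ∑-*ˡ (rows n) (ladder x c x x′ c′ x′) (λ r → ∑ (vectors (rows n) m) (λ S → sheet x′ c′ x′ r S r)))) ⟩
    ∑ bits (λ x′ → ∑ (rows m) (λ c′ → ladder x c x x′ c′ x′ *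
      ∑ (rows n) (λ r → ∑ (vectors (rows n) m) (λ S → sheet x′ c′ x′ r S r))))
      ≡⟨ ∑-cong bits (λ x′ → ∑-cong (rows m) (λ c′ →
           cong (ladder x c x x′ c′ x′ *_) (∑-sheet-ring n x′ c′))) ⟩
    ∑ bits (λ x′ → ∑ (rows m) (λ c′ → ladder x c x x′ c′ x′ *
      Ring.walks m n (x′ ∷ c′) (zeros (suc m))))
      ≡⟨ ∑-vectors-suc bits m _ ⟨
    Ring.walks m (suc n) (x ∷ c) (zeros (suc m)) ∎
    where open ≡-Reasoning

  -- Both sides count the independent sets on a cylinder of circumference m + 1 and length n: the
  -- trace closes up the sequence of rows, while the ring walk runs along the axis between two empty
  -- rings.
  trace-ring : ∀ m n → Row.trace n m ≡ Ring.walks m n (zeros (suc m)) (zeros (suc m))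
  trace-ring m n = trans
    (∑-cong (rows n) (λ r → trans (Row.walks-∑ n m r r)
      (∑-cong (vectors (rows n) m) (λ S → sym (sheet-zeros r S r)))))
    (∑-sheet-ring n false (zeros m))

  -- Independent sets as sparse 0-1 arrays

  module ⇔ = IsEquivalence (⇔-isEquivalence {ℓ = 0ℓ})

  *≡1⇔ : ∀ {m n} → m * n ≡ 1 ⇔ (m ≡ 1 × n ≡ 1)
  *≡1⇔ {m} {n} = mk⇔ (λ eq → m*n≡1⇒m≡1 m n eq , m*n≡1⇒n≡1 m n eq)
                     (λ { (refl , refl) → refl })

  Array : ℕ → ℕ → Set
  Array m n = Fin m → Fin n → Bool

  Near : ∀ {n} → Fin n → Fin n → Set
  Near i j = ∣ toℕ i - toℕ j ∣ ≤ 1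

  -- The common ground of `Independent` and of the products of blocks. Concluding equality from
  -- nearness, instead of excluding adjacency, lets the condition split along rows and columns.
  Sparse : ∀ {m n} → Array m n → Set
  Sparse σ = ∀ i j i′ j′ → σ i j ≡ true → σ i′ j′ ≡ true →
             Near i i′ → Near j j′ → i ≡ i′ × j ≡ j′

  Sparse-cong : ∀ {m n} {σ τ : Array m n} → (∀ i j → σ i j ≡ τ i j) → Sparse σ ⇔ Sparse τ
  Sparse-cong σ≗τ = mk⇔
    (λ s i j i′ j′ p p′ → s i j i′ j′ (trans (σ≗τ i j) p) (trans (σ≗τ i′ j′) p′))
    (λ s i j i′ j′ p p′ → s i j i′ j′ (trans (sym (σ≗τ i j)) p) (trans (sym (σ≗τ i′ j′)) p′))

  Sparse-flip : ∀ {m n} {σ : Array m n} → Sparse σ ⇔ Sparse (flip σ)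
  Sparse-flip {σ = σ} = mk⇔ (flipped σ) (flipped (flip σ))
    where
    flipped : ∀ {m n} (σ : Array m n) → Sparse σ → Sparse (flip σ)
    flipped σ s i j i′ j′ p p′ ni nj =
      let (e , e′) = s j i j′ i′ p p′ nj ni in e′ , e

  pair : {X : Set} → X → X → Fin 2 → X
  pair a b zero       = a
  pair a b (suc zero) = b

  -- Rows at distance at least 2 never interact, so every relevant pair lies within the first two
  -- rows or avoids the first row.
  Sparse-rows : ∀ {m n} {σ : Array (suc (suc m)) n} →
    Sparse σ ⇔ (Sparse (pair (σ zero) (σ (suc zero))) × Sparse (σ ∘ suc))
  Sparse-rows {σ = σ} = mk⇔ (λ s → top s , bottom s) (λ (t , b) → both t b)
    where
    top : Sparse σ → Sparse (pair (σ zero) (σ (suc zero)))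
    top s zero       j zero       j′ p p′ ni nj = refl , proj₂ (s zero j zero j′ p p′ ni nj)
    top s zero       j (suc zero) j′ p p′ ni nj with () ← proj₁ (s zero j (suc zero) j′ p p′ ni nj)
    top s (suc zero) j zero       j′ p p′ ni nj with () ← proj₁ (s (suc zero) j zero j′ p p′ ni nj)
    top s (suc zero) j (suc zero) j′ p p′ ni nj =
      refl , proj₂ (s (suc zero) j (suc zero) j′ p p′ ni nj)
    bottom : Sparse σ → Sparse (σ ∘ suc)
    bottom s i j i′ j′ p p′ ni nj =
      let (e , e′) = s (suc i) j (suc i′) j′ p p′ ni nj in Fin.suc-injective e , e′
    both : Sparse (pair (σ zero) (σ (suc zero))) → Sparse (σ ∘ suc) → Sparse σ
    both t b zero    j zero    j′ p p′ ni nj = refl , proj₂ (t zero j zero j′ p p′ ni nj)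
    both t b zero    j (suc zero) j′ p p′ ni nj with () ← proj₁ (t zero j (suc zero) j′ p p′ ni nj)
    both t b zero    j (suc (suc i′)) j′ p p′ (s≤s ()) nj
    both t b (suc zero) j zero j′ p p′ ni nj with () ← proj₁ (t (suc zero) j zero j′ p p′ ni nj)
    both t b (suc (suc i)) j zero j′ p p′ (s≤s ()) nj
    both t b (suc i) j (suc i′) j′ p p′ ni nj =
      let (e , e′) = b i j i′ j′ p p′ ni nj in cong suc e , e′

  Sparse-columns : ∀ {m n} {σ : Array m (suc (suc n))} →
    Sparse σ ⇔ (Sparse (λ i → pair (σ i zero) (σ i (suc zero))) × Sparse (λ i → σ i ∘ suc))
  Sparse-columns {σ = σ} = ⇔.trans Sparse-flip (⇔.trans Sparse-rows
    (⇔.trans (Sparse-cong pair-flip) Sparse-flip ×-⇔ Sparse-flip))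
    where
    pair-flip : ∀ j i → pair (λ i → σ i zero) (λ i → σ i (suc zero)) j i ≡
                        pair (σ i zero) (σ i (suc zero)) j
    pair-flip zero       i = refl
    pair-flip (suc zero) i = refl

  -- In a 2 × 2 square any two entries are near, so sparse means at most one `true`. A square
  -- without any is covered by an arbitrary position.
  Concentrated : ∀ {m n} → Array m n → Set
  Concentrated σ = ∃₂ λ i₀ j₀ → ∀ i j → σ i j ≡ true → i ≡ i₀ × j ≡ j₀

  Concentrated⇒Sparse : ∀ {m n} {σ : Array m n} → Concentrated σ → Sparse σ
  Concentrated⇒Sparse (i₀ , j₀ , only) i j i′ j′ p p′ _ _ =
    let (e , e′) = only i j p ; (d , d′) = only i′ j′ p′ in trans e (sym d) , trans e′ (sym d′)

  square : (a b c d : Bool) → Array 2 2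
  square a b c d = pair (pair a b) (pair c d)

  block⇒Concentrated : ∀ a b c d → block a b c d ≡ 1 → Concentrated (square a b c d)
  block⇒Concentrated true  false false false _ = zero , zero , λ
    { zero zero _ → refl , refl ; zero (suc zero) () ; (suc zero) zero () ; (suc zero) (suc zero) () }
  block⇒Concentrated false true  false false _ = zero , suc zero , λ
    { zero zero () ; zero (suc zero) _ → refl , refl ; (suc zero) zero () ; (suc zero) (suc zero) () }
  block⇒Concentrated false false true  false _ = suc zero , zero , λ
    { zero zero () ; zero (suc zero) () ; (suc zero) zero _ → refl , refl ; (suc zero) (suc zero) () }
  block⇒Concentrated false false false d     _ = suc zero , suc zero , λ
    { zero zero () ; zero (suc zero) () ; (suc zero) zero () ; (suc zero) (suc zero) _ → refl , refl }

  Sparse⇒block : ∀ a b c d → Sparse (square a b c d) → block a b c d ≡ 1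
  Sparse⇒block true  true  _     _     s with () ← proj₂ (s zero zero zero (suc zero) refl refl z≤n ≤-refl)
  Sparse⇒block true  false true  _     s with () ← proj₁ (s zero zero (suc zero) zero refl refl ≤-refl z≤n)
  Sparse⇒block true  false false true  s with () ← proj₁ (s zero zero (suc zero) (suc zero) refl refl ≤-refl ≤-refl)
  Sparse⇒block true  false false false s = refl
  Sparse⇒block false true  true  _     s with () ← proj₁ (s zero (suc zero) (suc zero) zero refl refl ≤-refl ≤-refl)
  Sparse⇒block false true  false true  s with () ← proj₁ (s zero (suc zero) (suc zero) (suc zero) refl refl ≤-refl z≤n)
  Sparse⇒block false true  false false s = refl
  Sparse⇒block false false true  true  s with () ← proj₂ (s (suc zero) zero (suc zero) (suc zero) refl refl z≤n ≤-refl)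
  Sparse⇒block false false true  false s = refl
  Sparse⇒block false false false _     s = refl

  block⇔Sparse : ∀ a b c d → block a b c d ≡ 1 ⇔ Sparse (square a b c d)
  block⇔Sparse a b c d =
    mk⇔ (Concentrated⇒Sparse ∘ block⇒Concentrated a b c d) (Sparse⇒block a b c d)

  ladder⇔Sparse : ∀ {n} a (u : Vec Bool n) b a′ u′ b′ → ladder a u b a′ u′ b′ ≡ 1 ⇔
    Sparse (pair (lookup (a ∷ (u ∷ʳ b))) (lookup (a′ ∷ (u′ ∷ʳ b′))))
  ladder⇔Sparse a []      b a′ []        b′ = ⇔.trans (block⇔Sparse a b a′ b′) (Sparse-cong λ
    { zero zero → refl ; zero (suc zero) → refl ; (suc zero) zero → refl ; (suc zero) (suc zero) → refl })
  ladder⇔Sparse a (x ∷ u) b a′ (x′ ∷ u′) b′ = ⇔.trans *≡1⇔ (⇔.trans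
    (⇔.trans (block⇔Sparse a x a′ x′) (Sparse-cong head≗) ×-⇔
     ⇔.trans (ladder⇔Sparse x u b x′ u′ b′) (Sparse-cong tail≗))
    (⇔.sym Sparse-columns))
    where
    σ = pair (lookup (a ∷ x ∷ (u ∷ʳ b))) (lookup (a′ ∷ x′ ∷ (u′ ∷ʳ b′)))
    head≗ : ∀ i j → square a x a′ x′ i j ≡ pair (σ i zero) (σ i (suc zero)) j
    head≗ zero       j = refl
    head≗ (suc zero) j = refl
    tail≗ : ∀ i j → pair (lookup (x ∷ (u ∷ʳ b))) (lookup (x′ ∷ (u′ ∷ʳ b′))) i j ≡ σ i (suc j)
    tail≗ zero       j = refl
    tail≗ (suc zero) j = refl

  padded : ∀ {m n} → Vec Bool n → Vec (Vec Bool n) m → Vec Bool n → Array (suc (suc m)) (suc (suc n))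
  padded u S v i = lookup (false ∷ (lookup (u ∷ (S ∷ʳ v)) i ∷ʳ false))

  weight⇔Sparse : ∀ {m n} u (S : Vec (Vec Bool n) m) v → Row.weight n u S v ≡ 1 ⇔ Sparse (padded u S v)
  weight⇔Sparse u []      v = ⇔.trans (ladder⇔Sparse false u false false v false) (Sparse-cong λ
    { zero j → refl ; (suc zero) j → refl })
  weight⇔Sparse u (s ∷ S) v = ⇔.trans *≡1⇔ (⇔.trans
    (ladder⇔Sparse false u false false s false ×-⇔ weight⇔Sparse s S v)
    (⇔.sym Sparse-rows))

  weight-≤1 : ∀ {m n} u (S : Vec (Vec Bool n) m) v → Row.weight n u S v ≤ 1
  weight-≤1 u []      v = ladder-≤1 false u false false v false
  weight-≤1 u (s ∷ S) v = *-mono-≤ (ladder-≤1 false u false false s false) (weight-≤1 s S v)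

  lookup-pad : ∀ {X : Set} {n} (x : X) (u : Vec X n) y (j : Fin n) →
               lookup (x ∷ (u ∷ʳ y)) (suc (inject₁ j)) ≡ lookup u j
  lookup-pad x (a ∷ u) y zero    = refl
  lookup-pad x (a ∷ u) y (suc j) = lookup-pad a u y j

  snoc-inside : ∀ {X : Set} {n} (P : X → Set) (u : Vec X n) {y} → ¬ P y →
    ∀ k → P (lookup (u ∷ʳ y) k) → ∃ λ j → k ≡ inject₁ j × P (lookup u j)
  snoc-inside P []      ¬y zero    p = ⊥-elim (¬y p)
  snoc-inside P (a ∷ u) ¬y zero    p = zero , refl , p
  snoc-inside P (a ∷ u) ¬y (suc k) p =
    let (j , eq , q) = snoc-inside P u ¬y k p in suc j , cong suc eq , q

  pad-inside : ∀ {X : Set} {n} (P : X → Set) {x} (u : Vec X n) {y} → ¬ P x → ¬ P y →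
    ∀ k → P (lookup (x ∷ (u ∷ʳ y)) k) → ∃ λ j → k ≡ suc (inject₁ j) × P (lookup u j)
  pad-inside P u ¬x ¬y zero    p = ⊥-elim (¬x p)
  pad-inside P u ¬x ¬y (suc k) p =
    let (j , eq , q) = snoc-inside P u ¬y k p in j , cong suc eq , q

  entries : ∀ {m n} → Vec (Vec Bool n) m → Array m n
  entries S i = lookup (lookup S i)

  bordered : ∀ {m n} → Vec (Vec Bool n) m → Array (suc (suc m)) (suc (suc n))
  bordered {n = n} S = padded (zeros n) S (zeros n)

  bordered-inside : ∀ {m n} (S : Vec (Vec Bool n) m) i j → bordered S i j ≡ true →
    ∃₂ λ k l → i ≡ suc (inject₁ k) × j ≡ suc (inject₁ l) × entries S k l ≡ true
  bordered-inside {n = n} S i j p =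
    let (k , i≡ , p′) = pad-inside (λ r → lookup (false ∷ (r ∷ʳ false)) j ≡ true) S empty empty i p
        (l , j≡ , q)  = inside (lookup S k) p′
    in k , l , i≡ , j≡ , q
    where
    inside : ∀ r → lookup (false ∷ (r ∷ʳ false)) j ≡ true →
             ∃ λ l → j ≡ suc (inject₁ l) × lookup r l ≡ true
    inside r = pad-inside (_≡ true) r (λ ()) (λ ()) j
    empty : ¬ (lookup (false ∷ (zeros n ∷ʳ false)) j ≡ true)
    empty p with l , _ , q ← inside (zeros n) p with () ← trans (sym (lookup-replicate l false)) q

  bordered-entries : ∀ {m n} (S : Vec (Vec Bool n) m) i j →
    bordered S (suc (inject₁ i)) (suc (inject₁ j)) ≡ entries S i j
  bordered-entries {n = n} S i j rewrite lookup-pad (zeros n) S (zeros n) i =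
    lookup-pad false (lookup S i) false j

  Near-inner : ∀ {n} (i j : Fin n) → ∣ toℕ (inject₁ i) - toℕ (inject₁ j) ∣ ≡ ∣ toℕ i - toℕ j ∣
  Near-inner i j = cong₂ ∣_-_∣ (Fin.toℕ-inject₁ i) (Fin.toℕ-inject₁ j)

  inner-injective : ∀ {n} {i j : Fin n} → _≡_ {A = Fin (suc (suc n))} (suc (inject₁ i)) (suc (inject₁ j)) → i ≡ j
  inner-injective eq = Fin.inject₁-injective (Fin.suc-injective eq)

  -- The weight of a walk between empty rows sees the array inside a border of `false`. The border
  -- contains no selected entry, and inner positions keep their distances.
  Sparse-bordered : ∀ {m n} (S : Vec (Vec Bool n) m) → Sparse (bordered S) ⇔ Sparse (entries S)
  Sparse-bordered S = mk⇔ unpad pad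
    where
    unpad : Sparse (bordered S) → Sparse (entries S)
    unpad s i j i′ j′ p p′ ni nj =
      let (e , e′) = s (suc (inject₁ i)) (suc (inject₁ j)) (suc (inject₁ i′)) (suc (inject₁ j′))
                       (trans (bordered-entries S i j) p) (trans (bordered-entries S i′ j′) p′)
                       (subst (_≤ 1) (sym (Near-inner i i′)) ni) (subst (_≤ 1) (sym (Near-inner j j′)) nj)
      in inner-injective e , inner-injective e′
    pad : Sparse (entries S) → Sparse (bordered S)
    pad s i j i′ j′ p p′ ni nj
      with k , l , refl , refl , q ← bordered-inside S i j p
         | k′ , l′ , refl , refl , q′ ← bordered-inside S i′ j′ p′
      with refl , refl ← s k l k′ l′ q q′ (subst (_≤ 1) (Near-inner k k′) ni)
                                          (subst (_≤ 1) (Near-inner l l′) nj) = refl , refl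

  Independent⇔Sparse : ∀ {m n} (S : VertexSet m n) → Independent S ⇔ Sparse (entries S)
  Independent⇔Sparse S = mk⇔ sparse independent
    where
    sparse : Independent S → Sparse (entries S)
    sparse ind i j i′ j′ p p′ ni nj with ≡-dec Fin._≟_ Fin._≟_ (i , j) (i′ , j′)
    ... | yes eq = ,-injective eq
    ... | no neq = ⊥-elim (ind i j i′ j′ (lookup⇒[]= j _ p) (lookup⇒[]= j′ _ p′) (neq , ni , nj))
    independent : Sparse (entries S) → Independent S
    independent s i j i′ j′ p p′ (neq , ni , nj) =
      let (e , e′) = s i j i′ j′ ([]=⇒lookup p) ([]=⇒lookup p′) ni nj in neq (cong₂ _,_ e e′)

  length-filter : ∀ {X : Set} {P : X → Set} (P? : Decidable P) (g : X → ℕ) →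
    (∀ x → g x ≤ 1) → (∀ x → g x ≡ 1 ⇔ P x) → ∀ xs → length (filter P? xs) ≡ ∑ xs g
  length-filter P? g g≤1 g⇔P []       = refl
  length-filter P? g g≤1 g⇔P (x ∷ xs) with P? x
  ... | yes px = cong₂ _+_ (sym (Equivalence.from (g⇔P x) px)) (length-filter P? g g≤1 g⇔P xs)
  ... | no ¬px = cong₂ _+_ (sym g≡0) (length-filter P? g g≤1 g⇔P xs)
    where
    g≡0 : g x ≡ 0
    g≡0 = n<1⇒n≡0 (≤∧≢⇒< (g≤1 x) (¬px ∘ Equivalence.to (g⇔P x)))

  f≡F : ∀ m n → f m n ≡ F (suc m) (suc n)
  f≡F m n = trans
    (length-filter independent? (λ S → Row.weight (suc n) (zeros (suc n)) S (zeros (suc n)))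
      (λ S → weight-≤1 (zeros (suc n)) S (zeros (suc n)))
      (λ S → ⇔.trans (weight⇔Sparse (zeros (suc n)) S (zeros (suc n)))
               (⇔.trans (Sparse-bordered S) (⇔.sym (Independent⇔Sparse S))))
      (vertexSets m n))
    (sym (F-∑ (suc m) (suc n)))

  -- Certified power iteration

  -- Functions Vec Bool n → ℕ with ∅ for the zero function, so that the
  -- transfer operators only visit independent columns.
  data Trie : ℕ → Set where
    ∅    : ∀ {n} → Trie n
    leaf : ℕ → Trie 0
    node : ∀ {n} → Trie n → Trie n → Trie (suc n)

  get : ∀ {n} → Trie n → Vec Bool n → ℕ
  get ∅          _           = 0
  get (leaf k)   []          = k
  get (node s t) (false ∷ u) = get s u
  get (node s t) (true  ∷ u) = get t u

  tabulate : ∀ {n} → (Vec Bool n → ℕ) → Trie n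
  tabulate {zero}  g = leaf (g [])
  tabulate {suc n} g = node (tabulate (g ∘ (false ∷_))) (tabulate (g ∘ (true ∷_)))

  infixl 6 _⊕_
  _⊕_ : ∀ {n} → Trie n → Trie n → Trie n
  ∅        ⊕ t          = t
  leaf k   ⊕ leaf l     = leaf (k + l)
  node s t ⊕ node s′ t′ = node (s ⊕ s′) (t ⊕ t′)
  s        ⊕ ∅          = s

  -- sweep y z sums over the second line of a ladder; y and z tell whether
  -- its left and right ends are occupied.
  sweep : ∀ {n} (y z : Bool) → Trie n → Trie n
  sweep y     z     ∅          = ∅
  sweep true  true  (leaf k)   = ∅
  sweep true  false (leaf k)   = leaf k
  sweep false z     (leaf k)   = leaf k
  sweep false z     (node s t) = node (sweep false z s ⊕ sweep true z t) (sweep true z s)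
  sweep true  z     (node s t) = node (sweep false z s) ∅

  rowStep : ∀ {n} → Trie n → Trie n
  rowStep = sweep false false

  ringStep : ∀ {n} → Trie (suc n) → Trie (suc n)
  ringStep ∅          = ∅
  ringStep (node s t) = node (sweep false false s ⊕ sweep true true t) (sweep true true s)

  get-tabulate : ∀ {n} (g : Vec Bool n → ℕ) u → get (tabulate g) u ≡ g u
  get-tabulate g []          = refl
  get-tabulate g (false ∷ u) = get-tabulate (g ∘ (false ∷_)) u
  get-tabulate g (true  ∷ u) = get-tabulate (g ∘ (true ∷_)) u

  get-⊕ : ∀ {n} (s t : Trie n) u → get (s ⊕ t) u ≡ get s u + get t u
  get-⊕ ∅          t            u           = refl
  get-⊕ (leaf k)   (leaf l)     []          = refl
  get-⊕ (node s t) (node s′ t′) (false ∷ u) = get-⊕ s s′ u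
  get-⊕ (node s t) (node s′ t′) (true  ∷ u) = get-⊕ t t′ u
  get-⊕ (leaf k)   ∅            []          = sym (+-identityʳ k)
  get-⊕ (node s t) ∅            u           = sym (+-identityʳ (get (node s t) u))

  -- The occupation of an end of the ladder, when at most one of its two
  -- vertices is selected.
  data End : Bool → Bool → Bool → Set where
    neither : End false false false
    first   : End true  false true
    second  : End false true  true

  -- One bit per end is enough: whichever of the two end vertices is selected, it excludes both
  -- vertices of the neighbouring column.
  get-sweep : ∀ {n} {a b a′ b′ y z} → End a a′ y → End b b′ z → (t : Trie n) → ∀ u →
    get (sweep y z t) u ≡ ∑ (rows n) (λ u′ → ladder a u b a′ u′ b′ * get t u′)
  get-sweep {n} {a} {b} {a′} {b′} _ _ ∅ u = sym (trans
    (∑-cong (rows n) (λ u′ → *-zeroʳ (ladder a u b a′ u′ b′))) (∑-zero (rows n)))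
  get-sweep neither neither (leaf k) [] = sym (trans (+-identityʳ _) (+-identityʳ k))
  get-sweep neither first   (leaf k) [] = sym (trans (+-identityʳ _) (+-identityʳ k))
  get-sweep neither second  (leaf k) [] = sym (trans (+-identityʳ _) (+-identityʳ k))
  get-sweep first   neither (leaf k) [] = sym (trans (+-identityʳ _) (+-identityʳ k))
  get-sweep first   first   (leaf k) [] = refl
  get-sweep first   second  (leaf k) [] = refl
  get-sweep second  neither (leaf k) [] = sym (trans (+-identityʳ _) (+-identityʳ k))
  get-sweep second  first   (leaf k) [] = refl
  get-sweep second  second  (leaf k) [] = refl
  get-sweep {suc n} {a} {b} {a′} {b′} {y} {z} end end′ (node s t) (x ∷ u) =
    trans (split end x refl) (sym (trans (∑-vectors-suc bits n _) (cong (part false s +_) (+-identityʳ _))))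
    where
    part : Bool → Trie n → ℕ
    part x′ t = ∑ (rows n) (λ u′ → block a x a′ x′ * ladder x u b x′ u′ b′ * get t u′)
    allowed : ∀ {y′} x′ (t : Trie n) → End x x′ y′ →
      get (sweep y′ z t) u ≡ ∑ (rows n) (λ u′ → 1 * ladder x u b x′ u′ b′ * get t u′)
    allowed x′ t end″ = trans (get-sweep end″ end′ t u)
      (∑-cong (rows n) (λ u′ → cong (_* get t u′) (sym (*-identityˡ (ladder x u b x′ u′ b′)))))
    forbidden : ∀ p → p ≡ p + ∑ (rows n) (λ _ → 0)
    forbidden p = sym (trans (cong (p +_) (∑-zero (rows n))) (+-identityʳ p))
    split : End a a′ y → ∀ x₁ → x ≡ x₁ →
      get (sweep y z (node s t)) (x ∷ u) ≡ part false s + part true t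
    split neither false refl = trans (get-⊕ (sweep false z s) (sweep true z t) u)
      (cong₂ _+_ (allowed false s neither) (allowed true t second))
    split neither true  refl = trans (allowed false s first) (forbidden _)
    split first   false refl = trans (allowed false s neither) (forbidden _)
    split first   true  refl = sym (cong₂ _+_ (∑-zero (rows n)) (∑-zero (rows n)))
    split second  false refl = trans (allowed false s neither) (forbidden _)
    split second  true  refl = sym (cong₂ _+_ (∑-zero (rows n)) (∑-zero (rows n)))

  ladder-full : ∀ {n} (u : Vec Bool n) b u′ b′ → b ≡ true → b′ ≡ true → ladder true u b true u′ b′ ≡ 0
  ladder-full []          true []           true refl refl = refl
  ladder-full (false ∷ u) b    (_ ∷ u′)     b′   _    _    = refl
  ladder-full (true  ∷ u) b    (_ ∷ u′)     b′   _    _    = refl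

  get-ringStep : ∀ {n} (t : Trie (suc n)) u →
    get (ringStep t) u ≡ ∑ (rows (suc n)) (λ u′ → ringT u u′ * get t u′)
  get-ringStep {n} ∅ u = sym (trans
    (∑-cong (rows (suc n)) (λ u′ → *-zeroʳ (ringT u u′))) (∑-zero (rows (suc n))))
  get-ringStep {n} (node s t) (x ∷ u) = trans (split x)
    (sym (trans (∑-vectors-suc bits n _) (cong (∑ (rows n) (λ u′ → ringT (x ∷ u) (false ∷ u′) * get s u′) +_)
      (+-identityʳ _))))
    where
    split : ∀ x → get (ringStep (node s t)) (x ∷ u) ≡
      ∑ (rows n) (λ u′ → ringT (x ∷ u) (false ∷ u′) * get s u′) +
      ∑ (rows n) (λ u′ → ringT (x ∷ u) (true ∷ u′) * get t u′)
    split false = trans (get-⊕ (sweep false false s) (sweep true true t) u)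
      (cong₂ _+_ (get-sweep neither neither s u) (get-sweep second second t u))
    split true = trans (get-sweep first first s u) (sym (trans
      (cong (_ +_) (trans (∑-cong (rows n) (λ u′ → cong (_* get t u′) (ladder-full u true u′ true refl refl)))
        (∑-zero (rows n)))) (+-identityʳ _)))

  iterate : ∀ {n} → (Trie n → Trie n) → Trie n → ℕ → Trie n
  iterate step t zero    = t
  iterate step t (suc k) = step (iterate step t k)

  rowTrie : ∀ n → ℕ → Trie n
  rowTrie n = iterate rowStep (tabulate (λ u → rowT u (zeros n)))

  ringTrie : ∀ n → ℕ → Trie (suc n)
  ringTrie n = iterate ringStep (tabulate (λ u → ringT u (zeros (suc n))))

  get-rowTrie : ∀ n k u → get (rowTrie n k) u ≡ Row.walks n k u (zeros n)
  get-rowTrie n zero    u = get-tabulate (λ u → rowT u (zeros n)) u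
  get-rowTrie n (suc k) u = trans (get-sweep neither neither (rowTrie n k) u)
    (∑-cong (rows n) (λ u′ → cong (rowT u u′ *_) (get-rowTrie n k u′)))

  get-ringTrie : ∀ n k u → get (ringTrie n k) u ≡ Ring.walks n k u (zeros (suc n))
  get-ringTrie n zero    u = get-tabulate (λ u → ringT u (zeros (suc n))) u
  get-ringTrie n (suc k) u = trans (get-ringStep (ringTrie n k) u)
    (∑-cong (rows (suc n)) (λ u′ → cong (ringT u u′ *_) (get-ringTrie n k u′)))

  _·_≤?_·_ : ∀ {n} → ℕ → Trie n → ℕ → Trie n → Bool
  α · ∅        ≤? β · t          = true
  α · leaf k   ≤? β · leaf l     = α * k ≤ᵇ β * l
  α · node s t ≤? β · node s′ t′ = (α · s ≤? β · s′) ∧ (α · t ≤? β · t′)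
  -- Conservative: the test fails here even if all values of `s` are zero. Only soundness is used.
  α · s        ≤? β · ∅          = false

  ·≤?·-sound : ∀ {n} α (s : Trie n) β t → T (α · s ≤? β · t) → ∀ u → α * get s u ≤ β * get t u
  ·≤?·-sound α ∅          β t            p u  = ≤-trans (≤-reflexive (*-zeroʳ α)) z≤n
  ·≤?·-sound α (leaf k)   β (leaf l)     p [] = ≤ᵇ⇒≤ (α * k) (β * l) p
  ·≤?·-sound α (node s t) β (node s′ t′) p (false ∷ u) =
    ·≤?·-sound α s β s′ (proj₁ (Equivalence.to T-∧ p)) u
  ·≤?·-sound α (node s t) β (node s′ t′) p (true ∷ u) =
    ·≤?·-sound α t β t′ (proj₂ (Equivalence.to (T-∧ {α · s ≤? β · s′}) p)) u

  -- Left multiplication by a matrix with non-negative entries preserves entrywise inequalities, so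
  -- one comparison of two vectors controls all later ones.
  walks-mono : {A : Set} (xs : List A) (S : A → A → ℕ) → let open Transfer xs S in
    ∀ {α β m n v} → (∀ u → α * walks m u v ≤ β * walks n u v) →
    ∀ j u → α * walks (j + m) u v ≤ β * walks (j + n) u v
  walks-mono xs S {α} {β} le zero    u = le u
  walks-mono xs S {α} {β} {m} {n} {v} le (suc j) u = subst₂ _≤_ (scale α (j + m)) (scale β (j + n))
    (∑-mono xs (λ w → *-monoʳ-≤ (S u w) (walks-mono xs S {α} {β} le j w)))
    where
    open Transfer xs S
    scale : ∀ γ k → ∑ xs (λ w → S u w * (γ * walks k w v)) ≡ γ * walks (suc k) u v
    scale γ k = trans (∑-cong xs (λ w → x∙yz≈y∙xz (S u w) γ (walks k w v)))
                      (∑-*ˡ xs γ (λ w → S u w * walks k w v))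

  geometric-≤ : ∀ {α β} (z : ℕ → ℕ) → (∀ j → α * z (suc j) ≤ β * z j) →
                ∀ j → α ^ j * z j ≤ β ^ j * z 0
  geometric-≤         z step zero    = ≤-refl
  geometric-≤ {α} {β} z step (suc j) = begin
    α * α ^ j * z (suc j)   ≡⟨ trans (*-assoc α (α ^ j) _) (x∙yz≈y∙xz α (α ^ j) _) ⟩
    α ^ j * (α * z (suc j)) ≤⟨ *-monoʳ-≤ (α ^ j) (step j) ⟩
    α ^ j * (β * z j)       ≡⟨ x∙yz≈y∙xz (α ^ j) β (z j) ⟩
    β * (α ^ j * z j)       ≤⟨ *-monoʳ-≤ β (geometric-≤ {α} {β} z step j) ⟩
    β * (β ^ j * z 0)       ≡⟨ *-assoc β (β ^ j) (z 0) ⟨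
    β * β ^ j * z 0         ∎
    where
    open ≤-Reasoning

  geometric-≥ : ∀ {α β} (z : ℕ → ℕ) → (∀ j → β * z j ≤ α * z (suc j)) →
                ∀ j → β ^ j * z 0 ≤ α ^ j * z j
  geometric-≥         z step zero    = ≤-refl
  geometric-≥ {α} {β} z step (suc j) = begin
    β * β ^ j * z 0         ≡⟨ *-assoc β (β ^ j) (z 0) ⟩
    β * (β ^ j * z 0)       ≤⟨ *-monoʳ-≤ β (geometric-≥ {α} {β} z step j) ⟩
    β * (α ^ j * z j)       ≡⟨ x∙yz≈y∙xz β (α ^ j) (z j) ⟩
    α ^ j * (β * z j)       ≤⟨ *-monoʳ-≤ (α ^ j) (step j) ⟩
    α ^ j * (α * z (suc j)) ≡⟨ trans (*-assoc α (α ^ j) _) (x∙yz≈y∙xz α (α ^ j) _) ⟨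
    α * α ^ j * z (suc j)   ∎
    where
    open ≤-Reasoning

  -- Growth of F

  F-submultiplicative : ∀ a a′ b → F (a + a′) b ≤ F a b * F a′ b
  F-submultiplicative a a′ b = Row.walks-submultiplicative b a a′

  F-supermultiplicative : ∀ a a′ b → F a b * F a′ b ≤ F (a + suc a′) b
  F-supermultiplicative a a′ b = Row.walks-supermultiplicative b a a′

  F-zeroˡ : ∀ b → F 0 b ≡ 1
  F-zeroˡ = rowT-zeros

  F-monoˡ-≤ : ∀ {a a′} b → a ≤ a′ → F a b ≤ F a′ b
  F-monoˡ-≤ {a} b a≤a′ = go (≤⇒≤′ a≤a′)
    where
    go : ∀ {a′} → a ℕ.≤′ a′ → F a b ≤ F a′ b
    go ℕ.≤′-refl = ≤-refl
    go (ℕ.≤′-step {a′} a≤a′) = ≤-trans (go a≤a′) (subst₂ _≤_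
      (trans (cong (F a′ b *_) (F-zeroˡ b)) (*-identityʳ (F a′ b)))
      (cong (λ k → F k b) (+-comm a′ 1))
      (F-supermultiplicative a′ 0 b))

  1≤F : ∀ a b → 1 ≤ F a b
  1≤F a b = subst (_≤ F a b) (F-zeroˡ b) (F-monoˡ-≤ {0} {a} b z≤n)

  F-nonZero : ∀ a b → NonZero (F a b)
  F-nonZero a b = >-nonZero (1≤F a b)

  F-pow-≤ : ∀ a b c → F (c * a) b ≤ F a b ^ c
  F-pow-≤ a b zero    = ≤-reflexive (F-zeroˡ b)
  F-pow-≤ a b (suc c) = ≤-trans (F-submultiplicative a (c * a) b) (*-monoʳ-≤ (F a b) (F-pow-≤ a b c))

  F-pow-≥ : ∀ a b c → F a b ^ suc c ≤ F (a + c * suc a) b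
  F-pow-≥ a b zero    = ≤-reflexive (trans (*-identityʳ (F a b)) (cong (λ k → F k b) (sym (+-identityʳ a))))
  F-pow-≥ a b (suc c) = ≤-trans (*-monoʳ-≤ (F a b) (F-pow-≥ a b c))
    (F-supermultiplicative a (a + c * suc a) b)

  -- Consider the rectangle of size (a + 1)(c + 1) by (b + 1)(d + 1). It has room for (c + 1)(d + 1)
  -- copies of the a × b rectangle with empty lines between them, and it is cut into (a + 1)(b + 1)
  -- copies of the (c + 1) × (d + 1) rectangle.
  F-comparison : ∀ a b c d → F a b ^ (suc c * suc d) ≤ F (suc c) (suc d) ^ (suc a * suc b)
  F-comparison a b c d = begin
    F a b ^ (suc c * suc d)
      ≡⟨ ^-*-assoc (F a b) (suc c) (suc d) ⟨
    (F a b ^ suc c) ^ suc d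
      ≤⟨ ^-monoˡ-≤ (suc d) (F-pow-≥ a b c) ⟩
    F a′ b ^ suc d
      ≡⟨ cong (_^ suc d) (F-sym a′ b) ⟩
    F b a′ ^ suc d
      ≤⟨ F-pow-≥ b a′ d ⟩
    F (b + d * suc b) a′
      ≤⟨ F-monoˡ-≤ a′ (≤-trans (n≤1+n _) (≤-reflexive (*-comm (suc d) (suc b)))) ⟩
    F (suc b * suc d) a′
      ≤⟨ F-pow-≤ (suc d) a′ (suc b) ⟩
    F (suc d) a′ ^ suc b
      ≡⟨ cong (_^ suc b) (F-sym (suc d) a′) ⟩
    F a′ (suc d) ^ suc b
      ≤⟨ ^-monoˡ-≤ (suc b) (F-monoˡ-≤ (suc d) (≤-trans (n≤1+n _) (≤-reflexive (*-comm (suc c) (suc a))))) ⟩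
    F (suc a * suc c) (suc d) ^ suc b
      ≤⟨ ^-monoˡ-≤ (suc b) (F-pow-≤ (suc c) (suc d) (suc a)) ⟩
    (F (suc c) (suc d) ^ suc a) ^ suc b
      ≡⟨ ^-*-assoc (F (suc c) (suc d)) (suc a) (suc b) ⟩
    F (suc c) (suc d) ^ (suc a * suc b) ∎
    where
    open ≤-Reasoning
    -- This is (a + 1)(c + 1) - 1, since no empty row is needed after the last copy; monotonicity
    -- supplies the missing row.
    a′ = a + c * suc a

  module _ (z : ℕ → ℕ) (1≤z : ∀ i → 1 ≤ z i)
           (logConvex : ∀ i → z (suc i) * z (suc i) ≤ z i * z (suc (suc i))) where

    -- The quotients of consecutive terms do not decrease, hence all are at least the first one; the
    -- inequality is cross-multiplied.
    logConvex-ratio : ∀ i → z 1 * z i ≤ z 0 * z (suc i)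
    logConvex-ratio zero    = ≤-reflexive (*-comm (z 1) (z 0))
    logConvex-ratio (suc i) = *-cancelˡ-≤ (z i) {{>-nonZero (1≤z i)}} (begin
      z i * (z 1 * z (suc i))               ≡⟨ x∙yz≈yx∙z (z i) (z 1) (z (suc i)) ⟩
      z 1 * z i * z (suc i)                 ≤⟨ *-monoˡ-≤ (z (suc i)) (logConvex-ratio i) ⟩
      z 0 * z (suc i) * z (suc i)           ≡⟨ *-assoc (z 0) (z (suc i)) (z (suc i)) ⟩
      z 0 * (z (suc i) * z (suc i))         ≤⟨ *-monoʳ-≤ (z 0) (logConvex i) ⟩
      z 0 * (z i * z (suc (suc i)))         ≡⟨ x∙yz≈y∙xz (z 0) (z i) (z (suc (suc i))) ⟩
      z i * (z 0 * z (suc (suc i)))         ∎)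
      where open ≤-Reasoning

    logConvex-growth : ∀ i → z 1 ^ i ≤ z 0 ^ i * z i
    logConvex-growth i = begin
      z 1 ^ i          ≡⟨ *-identityʳ (z 1 ^ i) ⟨
      z 1 ^ i * 1      ≤⟨ *-monoʳ-≤ (z 1 ^ i) (1≤z 0) ⟩
      z 1 ^ i * z 0    ≤⟨ geometric-≥ {z 0} {z 1} z logConvex-ratio i ⟩
      z 0 ^ i * z i    ∎
      where open ≤-Reasoning

  odd : ℕ → ℕ
  odd m = m + suc m

  F-odd-logConvex : ∀ m b → F (odd (suc m)) b * F (odd (suc m)) b ≤ F (odd m) b * F (odd (suc (suc m))) b
  F-odd-logConvex m b = subst (λ k → F k b * F k b ≤ F (odd m) b * F (odd (suc (suc m))) b)
    (+-suc m (suc (suc m))) (Row.walks-logConvex b m (suc (suc m)) (zeros b))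

  F-odd-growth : ∀ m b i → F (odd (suc m)) b ^ i ≤ F (odd m) b ^ i * F (odd (i + m)) b
  F-odd-growth m b = logConvex-growth (λ i → F (odd (i + m)) b) (λ i → 1≤F (odd (i + m)) b)
    (λ i → F-odd-logConvex (i + m) b)

  F-1-≤ : ∀ b → F 1 b ≤ 2 ^ b
  F-1-≤ b = begin
    F 1 b        ≡⟨ F-sym 1 b ⟩
    F b 1        ≡⟨ cong (λ k → F k 1) (*-identityʳ b) ⟨
    F (b * 1) 1  ≤⟨ F-pow-≤ 1 1 b ⟩
    2 ^ b        ∎
    where open ≤-Reasoning

  -- Each use of `walks≤trace` removes 2 (k + 1) rows at the price of one factor. A single row
  -- remains, with at most `2 ^ b` independent sets.
  F-odd≤trace : ∀ k b j → F (odd (j * suc k)) b ≤ 2 ^ b * Row.trace b (odd k) ^ j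
  F-odd≤trace k b zero    = ≤-trans (F-1-≤ b) (≤-reflexive (sym (*-identityʳ (2 ^ b))))
  F-odd≤trace k b (suc j) = begin
    F (odd (suc k + j * suc k)) b
      ≡⟨ cong (λ m → F (odd m) b) (+-comm (suc k) (j * suc k)) ⟩
    F (odd (j * suc k + suc k)) b
      ≤⟨ Row.walks≤trace b (j * suc k) k (zeros b) ⟩
    F (odd (j * suc k)) b * t
      ≤⟨ *-monoˡ-≤ t (F-odd≤trace k b j) ⟩
    2 ^ b * t ^ j * t
      ≡⟨ trans (*-assoc (2 ^ b) (t ^ j) t) (cong (2 ^ b *_) (*-comm (t ^ j) t)) ⟩
    2 ^ b * (t * t ^ j) ∎
    where
    open ≤-Reasoning
    t = Row.trace b (odd k)

  -- Numerical bounds for the growth rates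

  lo hi one : ℕ
  lo  = 1342542258
  hi  = 1342652573
  one = 1000000000

  eventually≤ : ∀ {n} → (Trie n → Trie n) → ℕ → ℕ → Trie n → Bool
  eventually≤ step α β t = α · step t ≤? β · t

  eventually≥ : ∀ {n} → (Trie n → Trie n) → ℕ → ℕ → Trie n → Bool
  eventually≥ step α β t = β · t ≤? α · step t

  row-growth-≤ : ∀ n k α β → T (eventually≤ rowStep α β (rowTrie n k)) →
                 ∀ j → α ^ j * F (j + k) n ≤ β ^ j * F k n
  row-growth-≤ n k α β check = geometric-≤ {α} {β} (λ j → F (j + k) n) (λ j →
    subst (λ i → α * F i n ≤ β * F (j + k) n) (+-suc j k)
      (walks-mono (rows n) rowT {α} {β} base j (zeros n)))
    where
    base : ∀ u → α * Row.walks n (suc k) u (zeros n) ≤ β * Row.walks n k u (zeros n)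
    base u = subst₂ (λ x y → α * x ≤ β * y) (get-rowTrie n (suc k) u) (get-rowTrie n k u)
      (·≤?·-sound α (rowTrie n (suc k)) β (rowTrie n k) check u)

  row-growth-≥ : ∀ n k α β → T (eventually≥ rowStep α β (rowTrie n k)) →
                 ∀ j → β ^ j * F k n ≤ α ^ j * F (j + k) n
  row-growth-≥ n k α β check = geometric-≥ {α} {β} (λ j → F (j + k) n) (λ j →
    subst (λ i → β * F (j + k) n ≤ α * F i n) (+-suc j k)
      (walks-mono (rows n) rowT {β} {α} base j (zeros n)))
    where
    base : ∀ u → β * Row.walks n k u (zeros n) ≤ α * Row.walks n (suc k) u (zeros n)
    base u = subst₂ (λ x y → β * x ≤ α * y) (get-rowTrie n k u) (get-rowTrie n (suc k) u)
      (·≤?·-sound β (rowTrie n k) α (rowTrie n (suc k)) check u)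

  trace-growth : ∀ n k α β → T (eventually≤ ringStep α β (ringTrie n k)) →
                 ∃ λ C → ∀ j → α ^ j * Row.trace (j + k) n ≤ β ^ j * C
  trace-growth n k α β check = Ring.walks n k o o , λ j →
    subst (λ x → α ^ j * x ≤ β ^ j * Ring.walks n k o o) (sym (trace-ring n (j + k)))
      (geometric-≤ {α} {β} (λ j → Ring.walks n (j + k) o o) (λ j →
        subst (λ i → α * Ring.walks n i o o ≤ β * Ring.walks n (j + k) o o) (+-suc j k)
          (walks-mono (rows (suc n)) ringT {α} {β} base j o)) j)
    where
    o = zeros (suc n)
    base : ∀ u → α * Ring.walks n (suc k) u o ≤ β * Ring.walks n k u o
    base u = subst₂ (λ x y → α * x ≤ β * y) (get-ringTrie n (suc k) u) (get-ringTrie n k u)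
      (·≤?·-sound α (ringTrie n (suc k)) β (ringTrie n k) check u)

  -- The iteration counts 32 here and 18 below suffice for the ratios of
  -- consecutive vectors to be this close to the spectral radii.  Opaque,
  -- since the witness must never be evaluated.
  opaque
    trace-bound : ∃ λ C → ∀ j → (one ^ 12) ^ j * Row.trace (j + 32) 11 ≤ (hi ^ 12) ^ j * C
    trace-bound = trace-growth 11 32 (one ^ 12) (hi ^ 12) tt

  -- 29.273 exceeds the spectral radius of the width 11 transfer matrix.
  width11-bound : ∀ j → 1000 ^ j * F (j + 18) 11 ≤ 29273 ^ j * F 18 11
  width11-bound = row-growth-≤ 11 18 1000 29273 tt

  -- The number 29.273 reappears as a factor of the lower bound for the rate, so that it cancels in
  -- the quotient of the two widths and leaves exactly (lo / one)².
  width13-bound : ∀ j → (29273 * lo ^ 2) ^ j * F 18 13 ≤ (1000 * one ^ 2) ^ j * F (j + 18) 13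
  width13-bound = row-growth-≥ 13 18 (1000 * one ^ 2) (29273 * lo ^ 2) tt

  ^-distribʳ-* : ∀ m n k → (m * n) ^ k ≡ m ^ k * n ^ k
  ^-distribʳ-* m n zero    = refl
  ^-distribʳ-* m n (suc k) = trans (cong (m * n *_) (^-distribʳ-* m n k)) (interchange m n (m ^ k) (n ^ k))

  -- `A` grows at rate at most q / p and `B` at rate at least (q x) / (p y), so q / p cancels.
  -- Because of `A₀ ≤ B₀` the initial values drop out as well, and no constant is left when a power
  -- is taken later.
  growth-ratio : ∀ p q x y j {A₀ A B₀ B} .{{_ : NonZero p}} .{{_ : NonZero q}} → 1 ≤ A₀ → A₀ ≤ B₀ →
    p ^ j * A ≤ q ^ j * A₀ → (q * x) ^ j * B₀ ≤ (p * y) ^ j * B → x ^ j * A ≤ y ^ j * B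
  growth-ratio p q x y j {A₀} {A} {B₀} {B} 1≤A₀ A₀≤B₀ A-bound B-bound =
    *-cancelˡ-≤ (p ^ j * q ^ j * A₀)
      {{m*n≢0 (p ^ j * q ^ j) A₀ {{m*n≢0 (p ^ j) (q ^ j) {{m^n≢0 p j}} {{m^n≢0 q j}}}} {{>-nonZero 1≤A₀}}}}
      (begin
        p ^ j * q ^ j * A₀ * (x ^ j * A)         ≤⟨ *-monoˡ-≤ (x ^ j * A) (*-monoʳ-≤ (p ^ j * q ^ j) A₀≤B₀) ⟩
        p ^ j * q ^ j * B₀ * (x ^ j * A)         ≡⟨ regroup₁ (p ^ j) (q ^ j) B₀ (x ^ j) A ⟩
        p ^ j * A * (q ^ j * x ^ j * B₀)         ≡⟨ cong (λ k → p ^ j * A * (k * B₀)) (^-distribʳ-* q x j) ⟨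
        p ^ j * A * ((q * x) ^ j * B₀)           ≤⟨ *-mono-≤ A-bound B-bound ⟩
        q ^ j * A₀ * ((p * y) ^ j * B)           ≡⟨ cong (λ k → q ^ j * A₀ * (k * B)) (^-distribʳ-* p y j) ⟩
        q ^ j * A₀ * (p ^ j * y ^ j * B)         ≡⟨ regroup₂ (p ^ j) (q ^ j) A₀ (y ^ j) B ⟩
        p ^ j * q ^ j * A₀ * (y ^ j * B)         ∎)
    where
    open ≤-Reasoning
    regroup₁ : ∀ p q b x a → p * q * b * (x * a) ≡ p * a * (q * x * b)
    regroup₁ = solve-∀
    regroup₂ : ∀ p q a y b → q * a * (p * y * b) ≡ p * q * a * (y * b)
    regroup₂ = solve-∀

  width-ratio : ∀ j → (lo ^ 2) ^ j * F 11 (j + 18) ≤ (one ^ 2) ^ j * F 13 (j + 18)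
  width-ratio j = growth-ratio 1000 29273 (lo ^ 2) (one ^ 2) j (1≤F 18 11)
    (subst₂ _≤_ (F-sym 11 18) (F-sym 13 18) (F-monoˡ-≤ {11} {13} 18 (m≤m+n 11 2)))
    (subst (λ k → 1000 ^ j * k ≤ 29273 ^ j * F 18 11) (F-sym (j + 18) 11) (width11-bound j))
    (subst (λ k → (29273 * lo ^ 2) ^ j * F 18 13 ≤ (1000 * one ^ 2) ^ j * k) (F-sym (j + 18) 13)
      (width13-bound j))

  F-odd-lower : ∀ x y m b i → x * F (odd m) b ≤ y * F (odd (suc m)) b →
                x ^ i ≤ y ^ i * F (odd (i + m)) b
  F-odd-lower x y m b i ratio = *-cancelˡ-≤ (A ^ i) {{m^n≢0 A i {{F-nonZero (odd m) b}}}} (begin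
    A ^ i * x ^ i                              ≡⟨ *-comm (A ^ i) (x ^ i) ⟩
    x ^ i * A ^ i                              ≡⟨ ^-distribʳ-* x A i ⟨
    (x * A) ^ i                                ≤⟨ ^-monoˡ-≤ i ratio ⟩
    (y * F (odd (suc m)) b) ^ i                ≡⟨ ^-distribʳ-* y (F (odd (suc m)) b) i ⟩
    y ^ i * F (odd (suc m)) b ^ i              ≤⟨ *-monoʳ-≤ (y ^ i) (F-odd-growth m b i) ⟩
    y ^ i * (A ^ i * F (odd (i + m)) b)        ≡⟨ x∙yz≈y∙xz (y ^ i) (A ^ i) (F (odd (i + m)) b) ⟩
    A ^ i * (y ^ i * F (odd (i + m)) b)        ∎)
    where
    open ≤-Reasoning
    A = F (odd m) b

  F-lower : ∀ i j → ((lo ^ 2) ^ j) ^ i ≤ ((one ^ 2) ^ j) ^ i * F (odd (i + 5)) (j + 18)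
  -- `odd 5` and `odd 6` are the widths 11 and 13 of `width-ratio`.
  F-lower i j = F-odd-lower ((lo ^ 2) ^ j) ((one ^ 2) ^ j) 5 (j + 18) i (width-ratio j)

open Counting using
  (F; f≡F; F-comparison; F-1-≤; odd; F-odd≤trace; lo; hi; one; F-lower; trace-bound; module Row)

open import Defs
open ℝ
open import Data.Integer.Base as ℤ using (+_)
import Data.Integer.Properties as ℤ
open import Data.Rational.Base
  using (ℚ; mkℚ; 0ℚ; 1ℚ; ½; _<_; _≤_; _+_; _*_; _-_; -_; _/_; _⊔_; toℚᵘ; positive)
open import Data.Rational.Properties
open import Data.Rational.Solver using (module +-*-Solver)
import Data.Rational.Unnormalised.Base as ℚᵘ
import Data.Rational.Unnormalised.Properties as ℚᵘ
open import Algebra.Properties.CommutativeSemiring.Exp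
  (CommutativeRing.commutativeSemiring +-*-commutativeRing)
  using (^-homo-*; ^-assocʳ; ^-distrib-*)

-- Powers of rationals

toℚᵘ-/ : ∀ n d → toℚᵘ (n / suc d) ℚᵘ.≃ ℚᵘ.mkℚᵘ n d
toℚᵘ-/ n d = toℚᵘ-fromℚᵘ (ℚᵘ.mkℚᵘ n d)

fromℕ-* : ∀ m n → fromℕ (m ℕ.* n) ≡ fromℕ m * fromℕ n
fromℕ-* m n = toℚᵘ-injective (begin-equality
  toℚᵘ (fromℕ (m ℕ.* n))                            ≃⟨ toℚᵘ-/ (+ (m ℕ.* n)) 0 ⟩
  ℚᵘ.mkℚᵘ (+ (m ℕ.* n)) 0                           ≡⟨ cong (λ k → ℚᵘ.mkℚᵘ k 0) (ℤ.pos-* m n) ⟩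
  ℚᵘ.mkℚᵘ (+ m) 0 ℚᵘ.* ℚᵘ.mkℚᵘ (+ n) 0              ≃⟨ ℚᵘ.*-cong (toℚᵘ-/ (+ m) 0) (toℚᵘ-/ (+ n) 0) ⟨
  toℚᵘ (fromℕ m) ℚᵘ.* toℚᵘ (fromℕ n)                ≃⟨ toℚᵘ-homo-* (fromℕ m) (fromℕ n) ⟨
  toℚᵘ (fromℕ m * fromℕ n)                          ∎)
  where open ℚᵘ.≤-Reasoning

fromℕ-suc : ∀ n → fromℕ (suc n) ≡ 1ℚ + fromℕ n
fromℕ-suc n = toℚᵘ-injective (begin-equality
  toℚᵘ (fromℕ (suc n))                  ≃⟨ toℚᵘ-/ (+ suc n) 0 ⟩
  ℚᵘ.mkℚᵘ (+ suc n) 0                   ≡⟨ cong (λ k → ℚᵘ.mkℚᵘ (+ 1 ℤ.+ k) 0) (ℤ.*-identityʳ (+ n)) ⟨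
  ℚᵘ.1ℚᵘ ℚᵘ.+ ℚᵘ.mkℚᵘ (+ n) 0           ≃⟨ ℚᵘ.+-congʳ ℚᵘ.1ℚᵘ (toℚᵘ-/ (+ n) 0) ⟨
  toℚᵘ 1ℚ ℚᵘ.+ toℚᵘ (fromℕ n)           ≃⟨ toℚᵘ-homo-+ 1ℚ (fromℕ n) ⟨
  toℚᵘ (1ℚ + fromℕ n)                   ∎)
  where open ℚᵘ.≤-Reasoning

fromℕ-mono-≤ : ∀ {m n} → m ℕ.≤ n → fromℕ m ≤ fromℕ n
fromℕ-mono-≤ {m} {n} m≤n = toℚᵘ-cancel-≤ (begin
  toℚᵘ (fromℕ m)        ≃⟨ toℚᵘ-/ (+ m) 0 ⟩
  ℚᵘ.mkℚᵘ (+ m) 0       ≤⟨ ℚᵘ.*≤* (ℤ.*-monoʳ-≤-nonNeg (+ 1) (ℤ.+≤+ m≤n)) ⟩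
  ℚᵘ.mkℚᵘ (+ n) 0       ≃⟨ toℚᵘ-/ (+ n) 0 ⟨
  toℚᵘ (fromℕ n)        ∎)
  where open ℚᵘ.≤-Reasoning

/-*-fromℕ : ∀ n d → ((+ n) / suc d) * fromℕ (suc d) ≡ fromℕ n
/-*-fromℕ n d = toℚᵘ-injective (begin-equality
  toℚᵘ (((+ n) / suc d) * fromℕ (suc d))            ≃⟨ toℚᵘ-homo-* ((+ n) / suc d) (fromℕ (suc d)) ⟩
  toℚᵘ ((+ n) / suc d) ℚᵘ.* toℚᵘ (fromℕ (suc d))    ≃⟨ ℚᵘ.*-cong (toℚᵘ-/ (+ n) d) (toℚᵘ-/ (+ suc d) 0) ⟩
  ℚᵘ.mkℚᵘ (+ n) d ℚᵘ.* ℚᵘ.mkℚᵘ (+ suc d) 0          ≃⟨ ℚᵘ.*≡* cross ⟩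
  ℚᵘ.mkℚᵘ (+ n) 0                                   ≃⟨ toℚᵘ-/ (+ n) 0 ⟨
  toℚᵘ (fromℕ n)                                    ∎)
  where
  open ℚᵘ.≤-Reasoning
  cross : + n ℤ.* + suc d ℤ.* + 1 ≡ + n ℤ.* + (suc d ℕ.* 1)
  cross = trans (ℤ.*-identityʳ (+ n ℤ.* + suc d)) (cong (λ k → + n ℤ.* + k) (sym (ℕ.*-identityʳ (suc d))))

fromℕ-^ : ∀ m k → fromℕ (m ℕ.^ k) ≡ fromℕ m ^ k
fromℕ-^ m zero    = refl
fromℕ-^ m (suc k) = trans (fromℕ-* m (m ℕ.^ k)) (cong (fromℕ m *_) (fromℕ-^ m k))

0≤fromℕ : ∀ n → 0ℚ ≤ fromℕ n
0≤fromℕ n = fromℕ-mono-≤ {0} {n} ℕ.z≤n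

archimedean : ∀ q → ∃ λ n → q < fromℕ n
archimedean q@(mkℚ p d _) = suc ℤ.∣ p ∣ , toℚᵘ-cancel-< (begin-strict
  toℚᵘ q                           <⟨ ℚᵘ.*<* cross ⟩
  ℚᵘ.mkℚᵘ (+ suc ℤ.∣ p ∣) 0        ≃⟨ toℚᵘ-/ (+ suc ℤ.∣ p ∣) 0 ⟨
  toℚᵘ (fromℕ (suc ℤ.∣ p ∣))       ∎)
  where
  open ℚᵘ.≤-Reasoning
  p≤∣p∣ : ∀ p → p ℤ.≤ + ℤ.∣ p ∣
  p≤∣p∣ (+ n)    = ℤ.≤-refl
  p≤∣p∣ ℤ.-[1+ n ] = ℤ.-≤+
  cross : p ℤ.* + 1 ℤ.< + suc ℤ.∣ p ∣ ℤ.* + suc d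
  cross = ℤ.≤-<-trans (ℤ.≤-trans (ℤ.≤-reflexive (ℤ.*-identityʳ p)) (p≤∣p∣ p))
    (ℤ.+<+ (ℕ.m≤m*n (suc ℤ.∣ p ∣) (suc d)))

open ≤-Reasoning
open +-*-Solver using (solve; _:=_; _:+_; _:*_; _:-_; con)

-- Opaque, so that abstracting over uses of it does not unfold
-- rational arithmetic.
opaque
  between : ∀ {p q} → p < q → ∃ λ r → p < r × r < q
  between = <-dense

-- The inequality 1 + m d / p ≤ (1 + d / p) ^ m multiplied by p ^ (m + 1), which avoids division and
-- allows p to be zero.
bernoulli : ∀ {p d} → 0ℚ ≤ p → 0ℚ ≤ d → ∀ m → p ^ m * (p + fromℕ m * d) ≤ p * (p + d) ^ m
bernoulli {p} {d} 0≤p 0≤d zero = ≤-reflexive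
  (solve 2 (λ p d → con 1ℚ :* (p :+ con 0ℚ :* d) := p :* con 1ℚ) refl p d)
bernoulli {p} {d} 0≤p 0≤d (suc m) = begin
  p * p ^ m * (p + fromℕ (suc m) * d)
    ≡⟨ cong (λ k → p * p ^ m * (p + k * d)) (fromℕ-suc m) ⟩
  p * p ^ m * (p + (1ℚ + x) * d)
    ≡⟨ +-identityʳ _ ⟨
  p * p ^ m * (p + (1ℚ + x) * d) + 0ℚ
    -- The added term is exactly the surplus of the product in the next line.
    ≤⟨ +-monoʳ-≤ (p * p ^ m * (p + (1ℚ + x) * d)) 0≤rest ⟩
  p * p ^ m * (p + (1ℚ + x) * d) + p ^ m * (x * (d * d))
    ≡⟨ solve 4 (λ p d x y → p :* y :* (p :+ (con 1ℚ :+ x) :* d) :+ y :* (x :* (d :* d)) :=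
                            (p :+ d) :* (y :* (p :+ x :* d))) refl p d x (p ^ m) ⟩
  (p + d) * (p ^ m * (p + x * d))
    ≤⟨ *-monoʳ-≤′ (+-mono-≤ 0≤p 0≤d) (bernoulli 0≤p 0≤d m) ⟩
  (p + d) * (p * (p + d) ^ m)
    ≡⟨ solve 3 (λ a p y → a :* (p :* y) := p :* (a :* y)) refl (p + d) p ((p + d) ^ m) ⟩
  p * ((p + d) * (p + d) ^ m) ∎
  where
  x = fromℕ m
  0≤* : ∀ {a b} → 0ℚ ≤ a → 0ℚ ≤ b → 0ℚ ≤ a * b
  0≤* {a} {b} 0≤a 0≤b = subst (_≤ a * b) (*-zeroʳ a) (*-monoʳ-≤′ 0≤a 0≤b)
  0≤rest : 0ℚ ≤ p ^ m * (x * (d * d))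
  0≤rest = 0≤* (^-nonNeg m 0≤p) (0≤* (0≤fromℕ m) (0≤* 0≤d 0≤d))

0<- : ∀ {p q} → p < q → 0ℚ < q - p
0<- {p} {q} p<q = subst (_< q - p) (+-inverseʳ p) (+-monoˡ-< (- p) p<q)

opaque
  multiple-exceeds : ∀ b {d} → 0ℚ < d → ∃ λ m → b < fromℕ m * d
  multiple-exceeds b {d} 0<d =
    let (z , zd≡b) = quotient b 0<d ; (m , z<m) = archimedean z
    in m , subst (_< fromℕ m * d) zd≡b (*-monoˡ-<′ 0<d z<m)

-- Bernoulli gives one exponent `M` at which (q / p) ^ M reaches `K`; every later factor q / p only
-- helps.
^-outgrows : ∀ K {p q} → 0ℚ < p → p < q → ∃ λ M → ∀ m → M ℕ.≤ m → K * p ^ m ≤ q ^ m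
^-outgrows K {p} {q} 0<p p<q with M , Kp<Md ← multiple-exceeds (K * p) (0<- p<q) =
  M , λ m M≤m → later (ℕ.≤⇒≤′ M≤m)
  where
  d = q - p
  p+d≡q : p + d ≡ q
  p+d≡q = solve 2 (λ p q → p :+ (q :- p) := q) refl p q
  first : K * p ^ M ≤ q ^ M
  first = *-cancelʳ-≤-pos p {{positive 0<p}} (begin
    K * p ^ M * p              ≡⟨ solve 3 (λ K p y → K :* y :* p := y :* (K :* p)) refl K p (p ^ M) ⟩
    p ^ M * (K * p)            ≤⟨ *-monoʳ-≤′ (^-nonNeg M (<⇒≤ 0<p)) (<⇒≤ (<-trans Kp<Md
                                    (subst (_< p + fromℕ M * d) (+-identityˡ (fromℕ M * d))
                                      (+-monoˡ-< (fromℕ M * d) 0<p)))) ⟩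
    p ^ M * (p + fromℕ M * d)  ≤⟨ bernoulli (<⇒≤ 0<p) (<⇒≤ (0<- p<q)) M ⟩
    p * (p + d) ^ M            ≡⟨ trans (*-comm p ((p + d) ^ M)) (cong (λ r → r ^ M * p) p+d≡q) ⟩
    q ^ M * p                  ∎)
  later : ∀ {m} → M ℕ.≤′ m → K * p ^ m ≤ q ^ m
  later ℕ.≤′-refl = first
  later (ℕ.≤′-step {m} M≤m) = begin
    K * (p * p ^ m)    ≡⟨ solve 3 (λ K p y → K :* (p :* y) := p :* (K :* y)) refl K p (p ^ m) ⟩
    p * (K * p ^ m)    ≤⟨ *-monoʳ-≤′ (<⇒≤ 0<p) (later M≤m) ⟩
    p * q ^ m          ≤⟨ *-monoˡ-≤′ (^-nonNeg m (<⇒≤ (<-trans 0<p p<q))) (<⇒≤ p<q) ⟩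
    q * q ^ m          ∎

^-swap : ∀ p m n → (p ^ m) ^ n ≡ (p ^ n) ^ m
^-swap p m n = trans (^-assocʳ p m n) (trans (cong (p ^_) (ℕ.*-comm m n)) (sym (^-assocʳ p n m)))

opaque
  -- A border of `C` rows and `D` columns is absorbed by any increase of the base: the passage from
  -- `p` to an intermediate `r` pays for the rows, that from `r` to `q` for the columns. It
  -- reconciles the different exponents in `Below` and `Above`.
  ^-grid : ∀ C D {p q} → 0ℚ < p → p < q → ∃ λ M → ∀ m n → M ℕ.≤ m → M ℕ.≤ n →
           p ^ ((C ℕ.+ m) ℕ.* (D ℕ.+ n)) ≤ q ^ (m ℕ.* n)
  ^-grid C D {p} {q} 0<p p<q
    with r , p<r , r<q ← between p<q
    with M₁ , grow₁ ← ^-outgrows (p ^ C) 0<p p<r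
    with M₂ , grow₂ ← ^-outgrows (r ^ D) (<-trans 0<p p<r) r<q =
    M₁ ℕ.⊔ M₂ , λ m n M≤m M≤n → begin
    p ^ ((C ℕ.+ m) ℕ.* (D ℕ.+ n))   ≡⟨ ^-assocʳ p (C ℕ.+ m) (D ℕ.+ n) ⟨
    (p ^ (C ℕ.+ m)) ^ (D ℕ.+ n)     ≤⟨ ^-mono-≤ (D ℕ.+ n) (^-nonNeg (C ℕ.+ m) (<⇒≤ 0<p))
                                         (shift p m C (grow₁ m (ℕ.≤-trans (ℕ.m≤m⊔n M₁ M₂) M≤m))) ⟩
    (r ^ m) ^ (D ℕ.+ n)             ≡⟨ ^-swap r m (D ℕ.+ n) ⟩
    (r ^ (D ℕ.+ n)) ^ m             ≤⟨ ^-mono-≤ m (^-nonNeg (D ℕ.+ n) (<⇒≤ (<-trans 0<p p<r)))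
                                         (shift r n D (grow₂ n (ℕ.≤-trans (ℕ.m≤n⊔m M₁ M₂) M≤n))) ⟩
    (q ^ n) ^ m                     ≡⟨ ^-swap q n m ⟩
    (q ^ m) ^ n                     ≡⟨ ^-assocʳ q m n ⟩
    q ^ (m ℕ.* n)                   ∎
    where
    shift : ∀ p m C {y} → p ^ C * p ^ m ≤ y → p ^ (C ℕ.+ m) ≤ y
    shift p m C {y} = subst (_≤ y) (sym (^-homo-* p C m))

-- The entropy constant

-- Records rather than Σ-types, so that with-abstraction does not
-- normalise their contents.
record Below (p : ℚ) : Set where
  constructor below
  field
    0<p   : 0ℚ < p
    a b   : ℕ
    bound : p ^ (suc a ℕ.* suc b) ≤ fromℕ (F a b)

record Above (p : ℚ) : Set where
  constructor above
  field
    0<p   : 0ℚ < p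
    a b   : ℕ
    bound : fromℕ (F (suc a) (suc b)) ≤ p ^ (suc a ℕ.* suc b)

-- If q < p, raising both bounds to the common exponent (a + 1)(b + 1)(c + 1)(d + 1) would
-- contradict `F-comparison`.
Below≤Above : ∀ {p q} → Below p → Above q → p ≤ q
Below≤Above {p} {q} (below 0<p a b p≤F) (above 0<q c d F≤q) = ≮⇒≥ λ q<p → <-irrefl refl (begin-strict
  (q ^ cd) ^ ab             ≡⟨ ^-swap q cd ab ⟩
  (q ^ ab) ^ cd             <⟨ ^-mono-< cd (^-nonNeg ab (<⇒≤ 0<q)) (^-mono-< ab (<⇒≤ 0<q) q<p) ⟩
  (p ^ ab) ^ cd             ≤⟨ ^-mono-≤ cd (^-nonNeg ab (<⇒≤ 0<p)) p≤F ⟩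
  fromℕ (F a b) ^ cd        ≡⟨ fromℕ-^ (F a b) cd ⟨
  fromℕ (F a b ℕ.^ cd)      ≤⟨ fromℕ-mono-≤ (F-comparison a b c d) ⟩
  fromℕ (F′ ℕ.^ ab)         ≡⟨ fromℕ-^ F′ ab ⟩
  fromℕ F′ ^ ab             ≤⟨ ^-mono-≤ ab (0≤fromℕ F′) F≤q ⟩
  (q ^ cd) ^ ab             ∎)
  where
  ab = suc a ℕ.* suc b
  cd = suc c ℕ.* suc d
  F′ = F (suc c) (suc d)

Below-1 : Below 1ℚ
Below-1 = below (positive⁻¹ 1ℚ) 0 0 ≤-refl

Above-2 : Above (fromℕ 2)
Above-2 = above (positive⁻¹ (fromℕ 2)) 0 0
  (subst (fromℕ (F 1 1) ≤_) (sym (*-identityʳ (fromℕ 2))) (fromℕ-mono-≤ (F-1-≤ 1)))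

opaque
  -- One large square decides: its count is compared with p to the power (M + 2)². If the count is
  -- smaller, `^-grid` replaces this power by q to the power (M + 1)², the exponent required by
  -- `Above`.
  Below⊎Above : ∀ {p q} → 0ℚ < p → p < q → Below p ⊎ Above q
  Below⊎Above {p} {q} 0<p p<q = choose (^-grid 1 1 0<p p<q)
    where
    choose : (∃ λ M → ∀ m n → M ℕ.≤ m → M ℕ.≤ n → p ^ (suc m ℕ.* suc n) ≤ q ^ (m ℕ.* n)) →
             Below p ⊎ Above q
    choose (M , grid) = decide (_ ≤? _)
      where
      decide : Dec (p ^ (suc (suc M) ℕ.* suc (suc M)) ≤ fromℕ (F (suc M) (suc M))) → Below p ⊎ Above q
      decide (yes p≤F) = inj₁ (below 0<p (suc M) (suc M) p≤F)
      decide (no  p≰F) = inj₂ (above (<-trans 0<p p<q) M M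
        (≤-trans (<⇒≤ (≰⇒> p≰F)) (grid (suc M) (suc M) (ℕ.n≤1+n M) (ℕ.n≤1+n M))))

-- The strict inequality next to `Below` and `Above` makes both halves of the cut open.
η : ℝ
η = record
  { L            = λ q → ∃ λ p → q < p × Below p
  ; U            = λ q → ∃ λ p → p < q × Above p
  ; L-inhabited  = 0ℚ , 1ℚ , positive⁻¹ 1ℚ , Below-1
  ; U-inhabited  = fromℕ 2 + 1ℚ , fromℕ 2 , p<p+q (fromℕ 2) (positive⁻¹ 1ℚ) , Above-2
  ; L-downClosed = λ p<q (r , q<r , lb) → r , <-trans p<q q<r , lb
  ; L-open       = λ (r , p<r , lb) →
                     let (q , p<q , q<r) = between p<r in q , p<q , r , q<r , lb
  ; U-upClosed   = λ p<q (r , r<p , ub) → r , <-trans r<p p<q , ub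
  ; U-open       = λ (r , r<q , ub) →
                     let (p , r<p , p<q) = between r<q in p , p<q , r , r<p , ub
  ; disjoint     = λ (p , q<p , lb) (r , r<q , ub) →
                     <-irrefl refl (<-≤-trans (<-trans r<q q<p) (Below≤Above lb ub))
  ; located      = loc
  }
  where
  loc : ∀ {p q} → p < q → (∃ λ r → p < r × Below r) ⊎ (∃ λ r → r < q × Above r)
  loc {p} p<q with p <? 1ℚ
  ... | yes p<1 = inj₁ (1ℚ , p<1 , Below-1)
  -- Now 1 ≤ p provides the positivity that `Below⊎Above` asks for; `r` and `s` leave room for a
  -- strict inequality at either end.
  ... | no  p≮1 with r , p<r , r<q ← between p<q
                with s , r<s , s<q ← between r<q
                with Below⊎Above (<-≤-trans (positive⁻¹ 1ℚ) (≤-trans (≮⇒≥ p≮1) (<⇒≤ p<r))) r<s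
  ...   | inj₁ lb = inj₁ (r , p<r , lb)
  ...   | inj₂ ub = inj₂ (s , s<q , ub)

-- Convergence of the normalized counts

opaque
  -- A walk upwards in steps of g < h: locatedness puts either l + g below x, and the walk goes on,
  -- or l + h above x, and it stops. The initial upper bound makes it finite.
  approximation : ∀ (x : ℝ) {h} → 0ℚ < h → ∃ λ q → L x q × U x (q + h)
  approximation x {h} 0<h
    with g , 0<g , g<h ← between 0<h
    with l , Ll ← L-inhabited x
    with u , Uu ← U-inhabited x
    with n , u-l<ng ← multiple-exceeds (u - l) 0<g =
    walk n l Ll (U-upClosed x (subst (_< l + fromℕ n * g)
      (solve 2 (λ l u → l :+ (u :- l) := u) refl l u) (+-monoʳ-< l u-l<ng)) Uu)
    where
    walk : ∀ n l → L x l → U x (l + fromℕ n * g) → ∃ λ q → L x q × U x (q + h)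
    walk zero    l Ll Uu = ⊥-elim (disjoint x Ll (subst (U x)
      (trans (cong (_+_ l) (*-zeroˡ g)) (+-identityʳ l)) Uu))
    walk (suc n) l Ll Uu with located x (+-monoʳ-< l g<h)
    ... | inj₂ Ul+h = l , Ll , Ul+h
    ... | inj₁ Ll+g = walk n (l + g) Ll+g (subst (U x) (trans (cong (λ k → l + k * g) (fromℕ-suc n))
      (solve 3 (λ l k g → l :+ (con 1ℚ :+ k) :* g := l :+ g :+ k :* g) refl l (fromℕ n) g)) Uu)

opaque
  halve : ∀ {e} → 0ℚ < e → ∃ λ h → 0ℚ < h × h + h ≡ e
  halve {e} 0<e = ½ * e , subst (_< ½ * e) (*-zeroʳ ½) (*-monoʳ-<′ (positive⁻¹ ½) 0<e) ,
    trans (sym (*-distribʳ-+ e ½ ½)) (*-identityˡ e)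

Uη⇒0< : ∀ {q} → U η q → 0ℚ < q
Uη⇒0< (p , p<q , ub) = <-trans (Above.0<p ub) p<q

Uη⇒F≤ : ∀ {q} → U η q → ∀ a b → fromℕ (F a b) ≤ q ^ (suc a ℕ.* suc b)
Uη⇒F≤ {q} Uq@(p , p<q , ub) a b = ≮⇒≥ λ q<F → <-irrefl refl (<-≤-trans p<q
  (Below≤Above (below (Uη⇒0< Uq) a b (<⇒≤ q<F)) ub))

Lη⇒<F : ∀ {q} → 0ℚ ≤ q → L η q → ∀ a b → q ^ (suc a ℕ.* suc b) < fromℕ (F (suc a) (suc b))
Lη⇒<F {q} 0≤q (p , q<p , lb) a b with r , q<r , r<p ← between q<p =
  ≰⇒> λ F≤q → <-irrefl refl (<-≤-trans r<p (Below≤Above lb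
    (above (≤-<-trans 0≤q q<r) a b (≤-trans F≤q (^-mono-≤ (suc a ℕ.* suc b) 0≤q (<⇒≤ q<r))))))

U-normalizedCount : ∀ {q} m n → 0ℚ < q → fromℕ (F (suc m) (suc n)) < q ^ (suc m ℕ.* suc n) →
                    U (normalizedCount m n) q
U-normalizedCount {q} m n 0<q F<q =
  0<q , subst (λ k → fromℕ k < q ^ (suc m ℕ.* suc n)) (sym (f≡F m n)) F<q

-- The exponent of a normalized count is the one in `Above`, so no count lies below `η`. This half
-- of the convergence holds for all m and n.
Lη⇒L-normalizedCount : ∀ {q} → L η q → ∀ m n → L (normalizedCount m n) q
Lη⇒L-normalizedCount {q} Lq m n = decide (q <? 0ℚ)
  where
  decide : Dec (q < 0ℚ) → L (normalizedCount m n) q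
  decide (yes q<0) = inj₁ q<0
  decide (no  q≮0) = inj₂ (subst (λ k → q ^ (suc m ℕ.* suc n) < fromℕ k) (sym (f≡F m n))
    (Lη⇒<F (≮⇒≥ q≮0) Lq m n))

-- Above `η` only the exponent (m + 2)(n + 2) is available; `^-grid` reduces it to (m + 1)(n + 1)
-- once m and n are large.
Uη⇒U-normalizedCount : ∀ {q r} → U η q → q < r →
  ∃ λ M → ∀ m n → M ℕ.≤ m → M ℕ.≤ n → U (normalizedCount m n) r
Uη⇒U-normalizedCount {q} {r} Uq q<r = via (between q<r)
  where
  0<q = Uη⇒0< Uq
  via : (∃ λ p → q < p × p < r) → ∃ λ M → ∀ m n → M ℕ.≤ m → M ℕ.≤ n → U (normalizedCount m n) r
  via (p , q<p , p<r) = let (M , grid) = ^-grid 1 1 0<q q<p in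
    M , λ m n M≤m M≤n → U-normalizedCount m n (<-trans 0<q q<r) (begin-strict
      fromℕ (F (suc m) (suc n))                ≤⟨ Uη⇒F≤ Uq (suc m) (suc n) ⟩
      q ^ (suc (suc m) ℕ.* suc (suc n))        ≤⟨ grid (suc m) (suc n) (ℕ.m≤n⇒m≤1+n M≤m) (ℕ.m≤n⇒m≤1+n M≤n) ⟩
      p ^ (suc m ℕ.* suc n)                    <⟨ ^-mono-< (suc m ℕ.* suc n) (<⇒≤ (<-trans 0<q q<p)) p<r ⟩
      r ^ (suc m ℕ.* suc n)                    ∎)

normalizedCount-limit : IsDoubleLimit normalizedCount η
normalizedCount-limit e 0<e = near (halve 0<e)
  where
  Near-η : ℚ → Set
  Near-η e = ∃ λ M → ∀ m n → M ℕ.≤ m → M ℕ.≤ n → ∣ normalizedCount m n - η ∣< e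
  nearer : ∀ {h} → 0ℚ < h → (∃ λ q → L η q × U η (q + h)) → Near-η (h + h)
  nearer {h} 0<h (q , Lq , Uq+h) =
    let (M , upper) = Uη⇒U-normalizedCount Uq+h (p<p+q (q + h) 0<h) in
    M , λ m n M≤m M≤n →
      -- One `h` is the gap of `approximation`, the other the slack in `Uη⇒U-normalizedCount`;
      -- together they make up `e`.
      (q + h + h , upper m n M≤m M≤n ,
        subst (L η) (solve 2 (λ q h → q := q :+ h :+ h :- (h :+ h)) refl q h) Lq) ,
      (q + h , Uq+h , Lη⇒L-normalizedCount (L-downClosed η q-h<q Lq) m n)
    where
    q-h<q : q + h - (h + h) < q
    q-h<q = subst (q + h - (h + h) <_) (solve 2 (λ q h → q :+ h :- (h :+ h) :+ h := q) refl q h)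
      (p<p+q (q + h - (h + h)) 0<h)
  near : (∃ λ h → 0ℚ < h × h + h ≡ e) → Near-η e
  near (h , 0<h , h+h≡e) = subst Near-η h+h≡e (nearer 0<h (approximation η 0<h))

-- The numerical bounds for `η`

record Fraction (x : ℚ) (n d : ℕ) : Set where
  constructor fraction
  field cleared : x * fromℕ d ≡ fromℕ n

-- Numerator and denominator stay the unreduced powers that occur in the integer bounds, whereas
-- `_/_` would reduce them by their gcd.
fraction-^ : ∀ {x n d} → Fraction x n d → ∀ k → Fraction (x ^ k) (n ℕ.^ k) (d ℕ.^ k)
fraction-^ {x} {n} {d} (fraction xd≡n) k = fraction (begin-equality
  x ^ k * fromℕ (d ℕ.^ k)    ≡⟨ cong (x ^ k *_) (fromℕ-^ d k) ⟩
  x ^ k * fromℕ d ^ k        ≡⟨ ^-distrib-* x (fromℕ d) k ⟨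
  (x * fromℕ d) ^ k          ≡⟨ cong (_^ k) xd≡n ⟩
  fromℕ n ^ k                ≡⟨ fromℕ-^ n k ⟨
  fromℕ (n ℕ.^ k)            ∎)

0<fromℕ : ∀ n .{{_ : NonZero n}} → 0ℚ < fromℕ n
0<fromℕ (suc n) = <-≤-trans (positive⁻¹ 1ℚ) (fromℕ-mono-≤ {1} {suc n} (ℕ.s≤s ℕ.z≤n))

≤-fraction : ∀ {x n d} .{{_ : NonZero d}} → Fraction x n d →
             ∀ {s t} → n ℕ.* s ℕ.≤ d ℕ.* t → x * fromℕ s ≤ fromℕ t
≤-fraction {x} {n} {d} (fraction xd≡n) {s} {t} ns≤dt = *-cancelˡ-≤-pos (fromℕ d) {{positive (0<fromℕ d)}} (begin
  fromℕ d * (x * fromℕ s)    ≡⟨ *-assoc (fromℕ d) x (fromℕ s) ⟨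
  fromℕ d * x * fromℕ s      ≡⟨ cong (_* fromℕ s) (trans (*-comm (fromℕ d) x) xd≡n) ⟩
  fromℕ n * fromℕ s          ≡⟨ fromℕ-* n s ⟨
  fromℕ (n ℕ.* s)            ≤⟨ fromℕ-mono-≤ ns≤dt ⟩
  fromℕ (d ℕ.* t)            ≡⟨ fromℕ-* d t ⟩
  fromℕ d * fromℕ t          ∎)

≥-fraction : ∀ {x n d} .{{_ : NonZero d}} → Fraction x n d →
             ∀ {s t} → d ℕ.* s ℕ.≤ n ℕ.* t → fromℕ s ≤ x * fromℕ t
≥-fraction {x} {n} {d} (fraction xd≡n) {s} {t} ds≤nt = *-cancelˡ-≤-pos (fromℕ d) {{positive (0<fromℕ d)}} (begin
  fromℕ d * fromℕ s          ≡⟨ fromℕ-* d s ⟨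
  fromℕ (d ℕ.* s)            ≤⟨ fromℕ-mono-≤ ds≤nt ⟩
  fromℕ (n ℕ.* t)            ≡⟨ fromℕ-* n t ⟩
  fromℕ n * fromℕ t          ≡⟨ cong (_* fromℕ t) (trans (*-comm (fromℕ d) x) xd≡n) ⟨
  fromℕ d * x * fromℕ t      ≡⟨ *-assoc (fromℕ d) x (fromℕ t) ⟩
  fromℕ d * (x * fromℕ t)    ∎)

^-monoʳ-≤ : ∀ {p} → 1ℚ ≤ p → ∀ {m n} → m ℕ.≤ n → p ^ m ≤ p ^ n
^-monoʳ-≤ {p} 1≤p {n = n} ℕ.z≤n = 1≤^ n 1≤p
^-monoʳ-≤ {p} 1≤p (ℕ.s≤s m≤n) = *-monoʳ-≤′ (≤-trans (nonNegative⁻¹ 1ℚ) 1≤p) (^-monoʳ-≤ 1≤p m≤n)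

module _ {r : ℚ} (0<r : 0ℚ < r) (r≡lo/one : Fraction r lo one) where

  F-lowerℚ : ∀ i j → ((r ^ 2) ^ j) ^ i ≤ fromℕ (F (odd (i ℕ.+ 5)) (j ℕ.+ 18))
  F-lowerℚ i j = subst (_≤ fromℕ (F (odd (i ℕ.+ 5)) (j ℕ.+ 18))) (*-identityʳ (((r ^ 2) ^ j) ^ i))
    (≤-fraction {{ℕ.m^n≢0 ((one ℕ.^ 2) ℕ.^ j) i {{ℕ.m^n≢0 (one ℕ.^ 2) j}}}}
      (fraction-^ (fraction-^ (fraction-^ r≡lo/one 2) j) i) {1}
      (subst (ℕ._≤ ((one ℕ.^ 2) ℕ.^ j) ℕ.^ i ℕ.* F (odd (i ℕ.+ 5)) (j ℕ.+ 18))
        (sym (ℕ.*-identityʳ (((lo ℕ.^ 2) ℕ.^ j) ℕ.^ i))) (F-lower i j)))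

  below-lo : ∀ {p} → 0ℚ < p → p < r → Below p
  -- The exponent in `Below` is (odd (M + 5) + 1)(M + 18 + 1) = 2 (6 + M)(19 + M), hence the borders
  -- 6 and 19 and the bases p² and r².
  below-lo {p} 0<p p<r with M , grid ← ^-grid 6 19 (^-pos 2 0<p) (^-mono-< 2 (<⇒≤ 0<p) p<r) =
    below 0<p (odd (M ℕ.+ 5)) (M ℕ.+ 18) (begin
      p ^ (suc (odd (M ℕ.+ 5)) ℕ.* suc (M ℕ.+ 18))    ≡⟨ cong (p ^_) (exponent M) ⟩
      p ^ (2 ℕ.* ((6 ℕ.+ M) ℕ.* (19 ℕ.+ M)))          ≡⟨ ^-assocʳ p 2 ((6 ℕ.+ M) ℕ.* (19 ℕ.+ M)) ⟨
      (p ^ 2) ^ ((6 ℕ.+ M) ℕ.* (19 ℕ.+ M))            ≤⟨ grid M M ℕ.≤-refl ℕ.≤-refl ⟩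
      (r ^ 2) ^ (M ℕ.* M)                             ≡⟨ ^-assocʳ (r ^ 2) M M ⟨
      ((r ^ 2) ^ M) ^ M                               ≤⟨ F-lowerℚ M M ⟩
      fromℕ (F (odd (M ℕ.+ 5)) (M ℕ.+ 18))            ∎)
    where
    exponent : ∀ m → suc (m ℕ.+ 5 ℕ.+ suc (m ℕ.+ 5)) ℕ.* suc (m ℕ.+ 18) ≡ 2 ℕ.* ((6 ℕ.+ m) ℕ.* (19 ℕ.+ m))
    exponent = solve-∀

  η-lower : fromℚ r ≤ʳ η
  η-lower q q<r = let (p , q⊔0<p , p<r) = between (⊔-< q<r 0<r) in
    p , ≤-<-trans (p≤p⊔q q 0ℚ) q⊔0<p , below-lo (≤-<-trans (p≤q⊔p q 0ℚ) q⊔0<p) p<r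

above′ : ∀ {p a b a′ b′} → a ≡ suc a′ → b ≡ suc b′ → 0ℚ < p → fromℕ (F a b) ≤ p ^ (a ℕ.* b) → Above p
above′ {a′ = a′} {b′} refl refl 0<p F≤p = above 0<p a′ b′ F≤p

module _ {r : ℚ} (1≤r : 1ℚ ≤ r) (r≡hi/one : Fraction r hi one) where

  private
    0<r : 0ℚ < r
    0<r = <-≤-trans (positive⁻¹ 1ℚ) 1≤r

  trace-boundℚ : ∃ λ C → ∀ j → fromℕ (Row.trace (j ℕ.+ 32) 11) ≤ (r ^ 12) ^ j * C
  trace-boundℚ = let (C , bound) = trace-bound in
    fromℕ C , λ j → ≥-fraction {{ℕ.m^n≢0 (one ℕ.^ 12) j}} (fraction-^ (fraction-^ r≡hi/one 12) j) (bound j)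

  above-hi : ∀ {p} → r < p → Above p
  above-hi {p} r<p = let (C , t≤) = trace-boundℚ in
    from C t≤ (^-outgrows (fromℕ 2 * C) (^-pos 12 0<r) (^-mono-< 12 (<⇒≤ 0<r) r<p))
    where
    n t : ℕ → ℕ
    n M = M ℕ.+ 32
    t M = Row.trace (n M) 11
    0<p : 0ℚ < p
    0<p = <-trans 0<r r<p
    0≤2t : ∀ M → 0ℚ ≤ fromℕ 2 * fromℕ (t M)
    0≤2t M = subst (0ℚ ≤_) (fromℕ-* 2 (t M)) (0≤fromℕ (2 ℕ.* t M))
    -- The number of trace factors is chosen equal to the length `n`, so that `2 ^ n` enters the
    -- n-th power as a single factor 2.
    F≤ : ∀ n → fromℕ (F (odd (n ℕ.* 6)) n) ≤ (fromℕ 2 * fromℕ (Row.trace n 11)) ^ n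
    F≤ n = begin
      fromℕ (F (odd (n ℕ.* 6)) n)               ≤⟨ fromℕ-mono-≤ (F-odd≤trace 5 n n) ⟩
      fromℕ (2 ℕ.^ n ℕ.* x ℕ.^ n)               ≡⟨ fromℕ-* (2 ℕ.^ n) (x ℕ.^ n) ⟩
      fromℕ (2 ℕ.^ n) * fromℕ (x ℕ.^ n)         ≡⟨ cong₂ _*_ (fromℕ-^ 2 n) (fromℕ-^ x n) ⟩
      fromℕ 2 ^ n * fromℕ x ^ n                 ≡⟨ ^-distrib-* (fromℕ 2) (fromℕ x) n ⟨
      (fromℕ 2 * fromℕ x) ^ n                   ∎
      where x = Row.trace n 11
    -- The ring bound yields only 12 M in the exponent. Since 1 ≤ p, it may be raised to the actual
    -- width 12 (M + 32) + 1.
    12M≤ : ∀ M → 12 ℕ.* M ℕ.≤ odd (n M ℕ.* 6)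
    12M≤ M = ℕ.≤-trans (ℕ.*-monoʳ-≤ 12 (ℕ.m≤m+n M 32))
      (ℕ.≤-trans (ℕ.≤-reflexive (12n≡ (n M))) (ℕ.+-monoʳ-≤ (n M ℕ.* 6) (ℕ.n≤1+n (n M ℕ.* 6))))
      where
      12n≡ : ∀ n → 12 ℕ.* n ≡ n ℕ.* 6 ℕ.+ n ℕ.* 6
      12n≡ = solve-∀

    from : ∀ C → (∀ j → fromℕ (t j) ≤ (r ^ 12) ^ j * C) →
           (∃ λ M → ∀ m → M ℕ.≤ m → fromℕ 2 * C * (r ^ 12) ^ m ≤ (p ^ 12) ^ m) → Above p
    from C t≤ (M , outgrow) =
      above′ {a = odd (n M ℕ.* 6)} {n M} (ℕ.+-suc (n M ℕ.* 6) (n M ℕ.* 6)) (ℕ.+-suc M 31) 0<p (begin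
        fromℕ (F (odd (n M ℕ.* 6)) (n M))         ≤⟨ F≤ (n M) ⟩
        (fromℕ 2 * fromℕ (t M)) ^ n M             ≤⟨ ^-mono-≤ (n M) (0≤2t M) (begin
          fromℕ 2 * fromℕ (t M)                     ≤⟨ *-monoʳ-≤′ (0≤fromℕ 2) (t≤ M) ⟩
          fromℕ 2 * ((r ^ 12) ^ M * C)              ≡⟨ cong (fromℕ 2 *_) (*-comm ((r ^ 12) ^ M) C) ⟩
          fromℕ 2 * (C * (r ^ 12) ^ M)              ≡⟨ *-assoc (fromℕ 2) C ((r ^ 12) ^ M) ⟨
          fromℕ 2 * C * (r ^ 12) ^ M                ≤⟨ outgrow M ℕ.≤-refl ⟩
          (p ^ 12) ^ M                              ∎) ⟩
        ((p ^ 12) ^ M) ^ n M                      ≡⟨ ^-assocʳ (p ^ 12) M (n M) ⟩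
        (p ^ 12) ^ (M ℕ.* n M)                    ≡⟨ ^-assocʳ p 12 (M ℕ.* n M) ⟩
        p ^ (12 ℕ.* (M ℕ.* n M))                  ≡⟨ cong (p ^_) (ℕ.*-assoc 12 M (n M)) ⟨
        p ^ (12 ℕ.* M ℕ.* n M)                    ≤⟨ ^-monoʳ-≤ (<⇒≤ (≤-<-trans 1≤r r<p)) (ℕ.*-monoˡ-≤ (n M) (12M≤ M)) ⟩
        p ^ (odd (n M ℕ.* 6) ℕ.* n M)             ∎)

  η-upper : η ≤ʳ fromℚ r
  η-upper q (p , q<p , lb) = <-≤-trans q<p (≮⇒≥ λ r<p →
    let (s , r<s , s<p) = between r<p in <-irrefl refl (<-≤-trans s<p (Below≤Above lb (above-hi r<s))))

mainTheorem4 : ∃ λ (η : ℝ) →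
    IsDoubleLimit normalizedCount η
    × fromℚ (+ 1342542258 / 1000000000) ≤ʳ η
    × η ≤ʳ fromℚ (+ 1342652573 / 1000000000)
mainTheorem4 = η , normalizedCount-limit ,
  η-lower (positive⁻¹ (+ 1342542258 / 1000000000)) (fraction (/-*-fromℕ 1342542258 999999999)) ,
  η-upper (toWitness {a? = 1ℚ ≤? + 1342652573 / 1000000000} tt) (fraction (/-*-fromℕ 1342652573 999999999))
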